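{- Let $m\ge3$ be an integer, let $\beta=\frac{m+\sqrt{m^2-4}}{2}$ (the larger root of $x^2-mx+1$), let $\alpha=1/\beta$, and let $\mathbf U=(U_k)$ be given by $U_{ -1}=0$, $U_0=1$, $U_{k+1}=mU_k-U_{k-1}$ for $k\in\mathbb N$. Let $n\ge1$ be an integer with $\mathbf U$-expansion $(n)_{\mathbf U}=a_Na_{N-1}\cdots a_1a_0$. For $1\le i\le N$, let $r_i=\sum_{j=0}^{i-1}a_jU_{i-1-j}$ be the integer having $\mathbf U$-representation $a_0a_1\cdots a_{i-1}$ (most significant digit $a_0$). Then $$P_\alpha(n)=a_N(r_N+1)+a_{N-1}(r_{N-1}+1)+\cdots+a_1(r_1+1)+a_0.$$
   Context: The $\mathbf U$-expansion of a positive integer $n$ is the unique string $a_Na_{N-1}\cdots a_0$ of nonnegative integers with $a_N\neq0$, $n=\sum_{k=0}^N a_kU_k$, and $\sum_{k=0}^i a_kU_k<U_{i+1}$ for every $i\le N$ (greedy expansion). For irrational $\alpha\in(0,1)$ and $n\ge1$, $P_\alpha(n)$ is the number of factors (finite contiguous blocks) $u$ of length $n$ of a Sturmian sequence over $\{a,b\}$ (aperiodic binary sequence in which any two factors of equal length have numbers of $b$'s differing by at most $1$) with frequency of the letter $b$ equal to $\alpha$, such that $|u|_a=\lfloor(1-\alpha)n\rfloor$ and $|u|_b=\lceil n\alpha\rceil$; this number does not depend on the choice of such a Sturmian sequence. -}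

module Defs where

open import Data.Nat.Base
open import Data.Bool.Base using (Bool; true; false; _∧_; _∨_; not; if_then_else_; T)
open import Data.List.Base using (List; []; _∷_; length; map; upTo)
open import Data.List.Relation.Unary.Unique.Propositional using (Unique)
open import Data.List.Membership.Propositional using (_∈_)
open import Data.Product.Base using (Σ; _×_; ∃)
open import Data.Sum.Base using (_⊎_)
open import Relation.Binary.PropositionalEquality using (_≡_; _≢_)
open import Relation.Nullary using (¬_)

-- The irrational number α = 1/β = (m - √(m²-4))/2, handled exactly.
-- (α is the smaller root of x² - m x + 1, hence equals 1/β.)

disc : ℕ → ℕ
disc m = m * m ∸ 4

-- ltα m p q  is true iff  p/q < α   (for q ≥ 1)
--   p/q < (m - √D)/2  ⇔  q√D < qm - 2p  ⇔  2p < qm ∧ q²D < (qm-2p)²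
ltα : ℕ → ℕ → ℕ → Bool
ltα m p q = (2 * p <ᵇ q * m) ∧ (q * q * disc m <ᵇ (q * m ∸ 2 * p) * (q * m ∸ 2 * p))

-- gtα m p q  is true iff  α < p/q   (for q ≥ 1)
--   (m - √D)/2 < p/q  ⇔  qm - 2p < q√D  ⇔  qm < 2p ∨ (qm-2p)² < q²D
gtα : ℕ → ℕ → ℕ → Bool
gtα m p q = (q * m <ᵇ 2 * p) ∨ ((q * m ∸ 2 * p) * (q * m ∸ 2 * p) <ᵇ q * q * disc m)

sumBelow : (ℕ → ℕ) → ℕ → ℕ
sumBelow f zero = 0
sumBelow f (suc n) = sumBelow f n + f n

countBelow : (ℕ → Bool) → ℕ → ℕ
countBelow P zero = 0
countBelow P (suc n) = countBelow P n + (if P n then 1 else 0)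

-- ⌈ n α ⌉ = #{ q ∈ {0,…,n} | q < n α }   (valid as 0 ≤ nα < n)
ceilNα : ℕ → ℕ → ℕ
ceilNα m n = countBelow (λ q → ltα m q n) (suc n)

-- ⌊ (1-α) n ⌋ = #{ q' ∈ {1,…,n} | q' ≤ n - nα }, and
--   q' ≤ n - nα  ⇔  α ≤ (n-q')/n  ⇔  not ((n-q')/n < α);   here q' = q+1
floorN1mα : ℕ → ℕ → ℕ
floorN1mα m n = countBelow (λ q → not (ltα m (n ∸ suc q) n)) n

U : ℕ → ℕ → ℕ
U m zero = 1
U m (suc zero) = m
U m (suc (suc k)) = m * U m (suc k) ∸ U m k

-- (n)_U = d N … d 1 d 0  (greedy U-expansion); digits d k for k > N are irrelevant
IsUExpansion : ℕ → ℕ → ℕ → (ℕ → ℕ) → Set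
IsUExpansion m n N d =
  (n ≡ sumBelow (λ k → d k * U m k) (suc N)) ×
  (d N ≢ 0) ×
  (∀ i → i ≤ N → sumBelow (λ k → d k * U m k) (suc i) < U m (suc i))

r : ℕ → (ℕ → ℕ) → ℕ → ℕ
r m d i = sumBelow (λ j → d j * U m (i ∸ 1 ∸ j)) i

formula : ℕ → ℕ → (ℕ → ℕ) → ℕ
formula m N d = sumBelow (λ i → d (suc i) * (r m d (suc i) + 1)) N + d 0

data Letter : Set where
  a b : Letter

Seq : Set
Seq = ℕ → Letter

counta : List Letter → ℕ
counta [] = 0
counta (a ∷ u) = suc (counta u)
counta (b ∷ u) = counta u

countb : List Letter → ℕ
countb [] = 0
countb (a ∷ u) = countb u
countb (b ∷ u) = suc (countb u)

factorAt : Seq → ℕ → ℕ → List Letter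
factorAt x i n = map (λ j → x (i + j)) (upTo n)

IsFactor : Seq → List Letter → Set
IsFactor x u = ∃ λ i → u ≡ factorAt x i (length u)

Balanced : Seq → Set
Balanced x = ∀ i j n → countb (factorAt x i n) ≤ suc (countb (factorAt x j n))

Aperiodic : Seq → Set
Aperiodic x = ¬ (Σ ℕ λ p → Σ ℕ λ K → (1 ≤ p) × (∀ i → K ≤ i → x (p + i) ≡ x i))

-- the frequency of b equals α:  for every ε = 1/(e+1) there is K such that for all
-- k ≥ max(K,1), with c = |x_0…x_{k-1}|_b :  c/k - ε < α < c/k + ε
HasFrequencyα : ℕ → Seq → Set
HasFrequencyα m x = ∀ e → ∃ λ K → ∀ k → K ≤ k → 1 ≤ k →
  ((countb (factorAt x 0 k) * suc e ≤ k)
     ⊎ T (ltα m (countb (factorAt x 0 k) * suc e ∸ k) (k * suc e)))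
  × T (gtα m (countb (factorAt x 0 k) * suc e + k) (k * suc e))

IsSturmianα : ℕ → Seq → Set
IsSturmianα m x = Balanced x × Aperiodic x × HasFrequencyα m x

IsCount : (List Letter → Set) → ℕ → Set
IsCount P k = Σ (List (List Letter)) λ L →
  Unique L × (length L ≡ k) × (∀ u → u ∈ L → P u) × (∀ u → P u → u ∈ L)

PαIs : ℕ → Seq → ℕ → ℕ → Set
PαIs m x n k = IsCount (λ u → IsFactor x u × (length u ≡ n)
                          × (counta u ≡ floorN1mα m n) × (countb u ≡ ceilNα m n)) k

{-# OPTIONS --safe #-}

-- Among the n + 1 factors of length n, the one read off with its maximum of
-- |x₀…x_{j−1}|_b − jα after t letters has ⌈nα⌉ letters b exactly when
-- 1 ≤ t ≤ n and {tα} ≤ {nα}, so P_α(n) is the rank of {nα} among {α}, …, {nα}.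
-- Passing from n to n + U_i < U_{i+1} raises every fractional part by the same
-- ‖U_iα‖, so the old t reappear as t + U_i; the new t ≤ U_i are those whose
-- residue t U_{i−1} mod U_i is at most that of n, which is r_i: there are
-- r_i + 1 of them.  All of this happens below a convergent U_K / U_{K+1} of α,
-- which can replace α in every comparison.

module Submission where

open import Defs
open import Data.Bool.Base using (Bool; true; false; not; T)
open import Data.Bool.Properties using (T-∧; T-∨)
open import Data.Empty using (⊥; ⊥-elim)
open import Data.List.Base using (List; []; _∷_; map; _++_; length; upTo; applyUpTo)
open import Data.List.Membership.Propositional using (_∈_)
open import Data.List.Membership.Propositional.Properties using (∈-map⁺; ∈-map⁻; ∈-++⁺ˡ; ∈-++⁺ʳ; ∈-++⁻)
open import Data.List.Properties using (length-map; length-++; length-upTo; map-upTo; map-∘; map-cong; ∷-injective)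
import Data.List.Relation.Unary.All as All
import Data.List.Relation.Unary.All.Properties as All
import Data.List.Relation.Unary.AllPairs as AllPairs
open import Data.List.Relation.Unary.Any using (here; there)
open import Data.List.Relation.Unary.Unique.Propositional using (Unique)
import Data.List.Relation.Unary.Unique.Propositional.Properties as Unique
open import Data.Nat.Base
open import Data.Nat.DivMod
open import Data.Nat.Properties
open import Data.Nat.Tactic.RingSolver using (solve-∀; solve)
open import Data.Product.Base using (_×_; _,_; proj₁; proj₂; ∃)
open import Data.Sum.Base using (_⊎_; inj₁; inj₂)
open import Function.Bundles using (Equivalence)
open import Relation.Binary.Definitions using (tri<; tri≈; tri>)
open import Relation.Binary.PropositionalEquality
open import Relation.Nullary using (¬_)

-- The reversed digits in r_i come from U_k U_{i-1} = U_{k-1} U_i + U_{i-1-k}: multiplication by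
-- U_{i-1} modulo U_i sends the weight of place k to that of place i-1-k. Adding U_i leaves this
-- residue unchanged, so each of the a_i copies of U_i contributes the same r_i + 1. The count is
-- exact because U_{i-1} is a unit modulo U_i: each residue belongs to exactly one t in 1, ..., U_i.
-- The supremum of |x₀...x_{j-1}|_b - jα need not be attained in the sequence. It is enough to have
-- a position that imitates it for blocks shorter than U_K, where n < U_K; every counted factor is
-- then a window of length n around that position. The frequency is known only through ε-bounds, so
-- α is enclosed between U_K / U_{K+1} and a fraction A/B with A U_{K+1} - U_K B = 1. No fraction of
-- denominator below U_{K+1} falls between the two, and ε can be taken as the reciprocal of a
-- product of two denominators.

-- Linear-arithmetic certificates: the hypotheses, weighted and added up, give
-- l ≤ u, and the remaining equation is a semiring identity.
linComb≤ : ∀ {l u x y} s → l ≤ u → x + u + s ≡ y + l → x ≤ y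
linComb≤ {l} {u} {x} {y} s l≤u eq = +-cancelʳ-≤ u x y
  (≤-trans (m≤m+n (x + u) s) (≤-trans (≤-reflexive eq) (+-monoʳ-≤ y l≤u)))

linComb⊥ : ∀ {l u} s → l ≤ u → suc (u + s) ≡ l → ⊥
linComb⊥ {l} {u} s l≤u eq = <-irrefl refl
  (≤-trans (s≤s (m≤m+n u s)) (≤-trans (≤-reflexive eq) l≤u))

linComb≡ : ∀ {l u x y} → l ≡ u → x + u ≡ y + l → x ≡ y
linComb≡ {l} {x = x} {y} refl eq = +-cancelʳ-≡ l x y eq

≤eq : ∀ {x y : ℕ} → x ≡ y → x ≤ y
≤eq = ≤-reflexive

≥eq : ∀ {x y : ℕ} → x ≡ y → y ≤ x
≥eq e = ≤-reflexive (sym e)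

infixr 5 _⊕_
infixr 6 _⊗_

_⊕_ : ∀ {x y u v} → x ≤ y → u ≤ v → x + u ≤ y + v
_⊕_ = +-mono-≤

_⊗_ : ∀ k {x y} → x ≤ y → k * x ≤ k * y
_⊗_ = *-monoʳ-≤

-- Floors and residues at a convergent, seen from a later one

-- The unimodular relation makes `p` a unit modulo `q`: if `f * q` were `j * p`, then `q` times the
-- difference of `j * q` and `f * q′` would be `j`, a multiple of `q` strictly between 0 and `q`.
multiple-free : ∀ {p q q′ f j} → q * q ≡ p * q′ + 1 → 1 ≤ j → j < q → f * q ≢ j * p
multiple-free {p} {q} {q′} {f} {j} qq 1≤j j<q eq with ≤-<-connex (j * q) (f * q′)
... | inj₁ le = linComb⊥ 0 (1≤j ⊕ q ⊗ le ⊕ q′ ⊗ ≤eq eq ⊕ j ⊗ ≥eq qq)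
      (solve (p ∷ q ∷ q′ ∷ f ∷ j ∷ []))
... | inj₂ lt = linComb⊥ 0 (j<q ⊕ q ⊗ lt ⊕ q′ ⊗ ≥eq eq ⊕ j ⊗ ≤eq qq)
      (solve (p ∷ q ∷ q′ ∷ f ∷ j ∷ []))

IsFloor : (P Q f j : ℕ) → Set
IsFloor P Q f j = (f * Q ≤ j * P) × (j * P < suc f * Q)

-- q = U_i, q′ = U_{i+1} and p = U_{i−1} seen from a later convergent P / Q;
-- w and w′ are the errors q P − p Q and q′ P − q Q.
record IsLevel (m P Q q q′ p w w′ : ℕ) : Set where
  field
    qP    : q * P ≡ p * Q + w
    q′P   : q′ * P ≡ q * Q + w′
    q′w   : q′ * w ≡ Q + q * w′
    qq    : q * q ≡ p * q′ + 1
    q′+p  : q′ + p ≡ m * q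
    1≤q   : 1 ≤ q
    1≤w   : 1 ≤ w
    2q≤q′ : 2 * q ≤ q′
    2w′≤w : 2 * w′ ≤ w

module Level {m P Q q q′ p w w′ : ℕ} (L : IsLevel m P Q q q′ p w w′) where
  open IsLevel L

  private
    vars = m ∷ P ∷ Q ∷ q ∷ q′ ∷ p ∷ w ∷ w′ ∷ []

  -- Adding `q` raises a fractional part by `w / Q`. The factor-two gaps, which come from `3 ≤ m`,
  -- bound this: `2 * q * w` is at most `q′ * w = Q + q * w′`, and `q * w′` is at most half of
  -- `q * w`.
  qw<Q : q * w < Q
  qw<Q = *-cancelˡ-< 2 (q * w) Q (linComb≤ 0
    (2 ⊗ (w ⊗ 2q≤q′) ⊕ 2 ⊗ ≤eq q′w ⊕ q ⊗ 2w′≤w ⊕ *-mono-≤ 1≤q 1≤w)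
    (solve vars))

  q′w′<Q : q′ * w′ < Q
  q′w′<Q = ≰⇒> λ (le : Q ≤ q′ * w′) → linComb⊥ (q * w)
    (qw<Q ⊕ 3 ⊗ le ⊕ 2 ⊗ q′ ⊗ 2w′≤w ⊕ 2 ⊗ ≤eq q′w ⊕ w′ ⊗ 2q≤q′)
    (solve vars)

  w′<w : w′ < w
  w′<w = ≰⇒> λ (le : w ≤ w′) → linComb⊥ 0 (2 ⊗ le ⊕ 2w′≤w ⊕ 1≤w) (solve vars)

  qw′<qw : q * w′ < q * w
  qw′<qw = *-monoʳ-< q {{>-nonZero 1≤q}} w′<w

  instance
    Q-nonZero : NonZero Q
    Q-nonZero = >-nonZero (≤-<-trans z≤n qw<Q)

    q-nonZero : NonZero q
    q-nonZero = >-nonZero 1≤q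

  -- Only a carry could spoil this. The excess of `suc f * q′` over `j * q` is positive since
  -- `q / q′` does not exceed `P / Q`; an excess of 2 or more leaves room for the increment, and an
  -- excess of 1 would make `q′` divide `j + q`, which lies strictly between 0 and `q′`.
  floor-shift : ∀ {f j} → j + q < q′ → IsFloor P Q f j → IsFloor P Q (f + p) (j + q)
  floor-shift {f} {j} j+q<q′ (lo , hi) = lower , ≰⇒> upper
    where
    lower : (f + p) * Q ≤ (j + q) * P
    lower = linComb≤ w (lo ⊕ ≥eq qP) (solve (f ∷ j ∷ vars))
    upper : ¬ suc (f + p) * Q ≤ (j + q) * P
    upper le with <-cmp (suc f * q′) (suc (j * q))
    ... | tri< lt _ _ = linComb⊥ (1 + j * w′)
          (q′ ⊗ hi ⊕ Q ⊗ lt ⊕ j ⊗ ≥eq q′P ⊕ 2 ⊗ 1≤q ⊕ 2q≤q′)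
          (solve (f ∷ j ∷ vars))
    ... | tri> _ _ gt = linComb⊥ w′
          (q′ ⊗ le ⊕ Q ⊗ gt ⊕ (j + q) ⊗ ≤eq q′P ⊕ Q ⊗ ≤eq qq ⊕ w′ ⊗ j+q<q′ ⊕ q′w′<Q)
          (solve (f ∷ j ∷ vars))
    ... | tri≈ _ eq _ with ≤-<-connex (suc f * q) (j * p)
    ...   | inj₁ ge = linComb⊥ j
            (q′ ⊗ ge ⊕ q ⊗ ≥eq eq ⊕ j ⊗ ≥eq qq ⊕ 1≤q)
            (solve (f ∷ j ∷ vars))
    ...   | inj₂ lt = linComb⊥ 0
            (q′ ⊗ lt ⊕ q ⊗ ≤eq eq ⊕ j ⊗ ≤eq qq ⊕ j+q<q′)
            (solve (f ∷ j ∷ vars))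

  -- The two fractional parts add up to `w / Q` or to `1 + w / Q`. The former is impossible: `f * q`
  -- differs from `j * p`, and a difference of either sign violates one of the lower floor bounds
  -- because `q * w < Q`.
  floor-complement : ∀ {f f′ j j′} → 1 ≤ j → 1 ≤ j′ → j + j′ ≡ q →
                     IsFloor P Q f j → IsFloor P Q f′ j′ → suc (f + f′) ≡ p
  floor-complement {f} {f′} {j} {j′} 1≤j 1≤j′ sum (lo , hi) (lo′ , hi′) =
    ≤-antisym (≤∧≢⇒< sum≤p sum≢p) p≤sum
    where
    allvars = f ∷ f′ ∷ j ∷ j′ ∷ vars
    p≤sum : p ≤ suc (f + f′)
    p≤sum = s≤s⁻¹ (*-cancelʳ-< Q p (2 + (f + f′)) (linComb≤ (1 + w)
      (hi ⊕ hi′ ⊕ P ⊗ ≥eq sum ⊕ ≥eq qP) (solve allvars)))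
    sum≤p : f + f′ ≤ p
    sum≤p = s≤s⁻¹ (*-cancelʳ-< Q (f + f′) (suc p) (linComb≤ 0
      (lo ⊕ lo′ ⊕ P ⊗ ≤eq sum ⊕ ≤eq qP ⊕ w ⊗ 1≤q ⊕ qw<Q) (solve allvars)))
    sum≢p : f + f′ ≢ p
    sum≢p eq with <-cmp (f * q) (j * p)
    ... | tri≈ _ e _ = multiple-free {f = f} qq 1≤j
            (subst (j <_) sum (m<m+n j 1≤j′)) e
    ... | tri< lt _ _ = linComb⊥ (j * w)
            (Q ⊗ lt ⊕ j ⊗ ≥eq qP ⊕ q ⊗ P ⊗ ≤eq sum ⊕ q ⊗ lo′ ⊕ q ⊗ Q ⊗ ≥eq eq ⊕ q ⊗ ≤eq qP ⊕ qw<Q)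
            (solve allvars)
    ... | tri> _ _ gt = linComb⊥ 0
            (Q ⊗ gt ⊕ j ⊗ ≤eq qP ⊕ q ⊗ lo ⊕ w ⊗ j≤q ⊕ qw<Q)
            (solve allvars)
      where
      j≤q : j ≤ q
      j≤q = subst (j ≤_) sum (m≤m+n j j′)

  level-upper : ∀ {f t} → IsFloor P Q f t → t * p < suc f * q
  level-upper {f} {t} (lo , hi) = *-cancelʳ-< Q (t * p) (suc f * q) (linComb≤ (t * w)
    (q ⊗ hi ⊕ t ⊗ ≥eq qP ⊕ 1≤q) (solve (f ∷ t ∷ vars)))

  -- Together with `level-upper`: for `t ≤ q` the slopes `p / q` and `P / Q` give the same floor,
  -- since `t * P / Q` exceeds `t * p / q` by at most `w / Q`, which is less than `1 / q`.
  level-lower : ∀ {f t} → t ≤ q → IsFloor P Q f t → f * q ≤ t * p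
  level-lower {f} {t} t≤q (lo , hi) = s≤s⁻¹ (*-cancelʳ-< Q (f * q) (suc (t * p)) (linComb≤ 0
    (q ⊗ lo ⊕ t ⊗ ≤eq qP ⊕ w ⊗ t≤q ⊕ qw<Q) (solve (f ∷ t ∷ vars))))

  -- Multiplication by −q′ inverts multiplication by p modulo q.
  residue-invert : ∀ {t n e f} δ → t * p + e * q ≡ n * p + f * q + δ →
    n + q * (t * q + e * q′) ≡ t + q * (n * q + f * q′) + δ * q′
  residue-invert {t} {n} {e} {f} δ eq = linComb≡
    (cong₂ _+_ (cong (q′ *_) eq) (cong₂ _+_ (cong (t *_) qq) (cong (n *_) (sym qq))))
    (solve (f ∷ t ∷ n ∷ e ∷ δ ∷ vars))

  residue-injective : ∀ {t t′ f f′} s → 1 ≤ t → t ≤ q → 1 ≤ t′ → t′ ≤ q →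
                      t * p ≡ s + f * q → t′ * p ≡ s + f′ * q → t ≡ t′
  residue-injective {t} {t′} {f} {f′} s 1≤t t≤q 1≤t′ t′≤q e e′ =
    ≤-antisym (≮⇒≥ (not-less {f = f′} {f} 1≤t′ t≤q e′ e))
              (≮⇒≥ (not-less {f = f} {f′} 1≤t t′≤q e e′))
    where
    not-less : ∀ {t t′ f f′} → 1 ≤ t → t′ ≤ q →
               t * p ≡ s + f * q → t′ * p ≡ s + f′ * q → ¬ t < t′
    not-less {t} {t′} {f} {f′} 1≤t t′≤q e e′ t<t′
      with residue-invert {t} {t′} {f′} {f} 0 (linComb≡ (cong₂ _+_ e (sym e′)) (solve (t ∷ t′ ∷ f ∷ f′ ∷ s ∷ vars)))
         | ≤-<-connex (t′ * q + f * q′) (t * q + f′ * q′)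
    ... | inv | inj₁ le = linComb⊥ 0
          (t<t′ ⊕ q ⊗ le ⊕ ≤eq inv) (solve (t ∷ t′ ∷ f ∷ f′ ∷ s ∷ vars))
    ... | inv | inj₂ lt = linComb⊥ 0
          (1≤t ⊕ t′≤q ⊕ q ⊗ lt ⊕ ≥eq inv) (solve (t ∷ t′ ∷ f ∷ f′ ∷ s ∷ vars))

  module _ {t n e f r s : ℕ} (s-eq : t * p ≡ s + f * q) (r-eq : n * p ≡ r + e * q) where

    order⇐ : s ≤ r → t ≤ n → t * P + e * Q ≤ n * P + f * Q
    order⇐ s≤r t≤n = *-cancelˡ-≤ q (linComb≤ 0
      (Q ⊗ s≤r ⊕ w ⊗ t≤n ⊕ t ⊗ ≤eq qP ⊕ n ⊗ ≥eq qP ⊕ Q ⊗ ≤eq s-eq ⊕ Q ⊗ ≥eq r-eq)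
      (solve (t ∷ n ∷ e ∷ f ∷ r ∷ s ∷ vars)))

    -- Multiplied by `q`, the fractional parts (over `Q`) become `s * Q + t * w` and
    -- `r * Q + n * w`. The bound `n * w < Q + q * w′` only excludes `s ≥ r + 2`, so `s = r + 1`
    -- needs an arithmetic argument.
    order⇒ : n < q′ → t * P + e * Q ≤ n * P + f * Q → s ≤ r
    order⇒ n<q′ le = ≮⇒≥ contra
      where
      allvars = t ∷ n ∷ e ∷ f ∷ r ∷ s ∷ vars
      scaled : s * Q + t * w ≤ r * Q + n * w
      scaled = linComb≤ 0
        (q ⊗ le ⊕ t ⊗ ≥eq qP ⊕ n ⊗ ≤eq qP ⊕ Q ⊗ ≥eq s-eq ⊕ Q ⊗ ≤eq r-eq)
        (solve allvars)
      contra : ¬ r < s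
      contra r<s with m≤n⇒m<n∨m≡n r<s
      ... | inj₁ r+2≤s = linComb⊥ (q * w′ + t * w + w)
            (scaled ⊕ Q ⊗ r+2≤s ⊕ w ⊗ n<q′ ⊕ ≤eq q′w ⊕ qw<Q ⊕ q ⊗ 2w′≤w)
            (solve allvars)
      -- Here `n − t` is congruent to `q′` modulo `q` and below `q′`, hence at most `q′ − q`; but
      -- `(q′ − q) * w < Q` because `w′ < w`.
      ... | inj₂ refl
        with residue-invert {t} {n} {e} {f} 1 (linComb≡ (cong₂ _+_ s-eq (sym r-eq)) (solve (t ∷ n ∷ e ∷ f ∷ r ∷ vars)))
           | ≤-<-connex (t * q + e * q′) (n * q + f * q′)
      ...   | inv | inj₁ ge = linComb⊥ t
              (n<q′ ⊕ q ⊗ ge ⊕ ≥eq inv) (solve (t ∷ n ∷ e ∷ f ∷ r ∷ vars))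
      ...   | inv | inj₂ lt = linComb⊥ 0
              (scaled ⊕ w ⊗ q ⊗ lt ⊕ w ⊗ ≤eq inv ⊕ ≤eq q′w ⊕ qw′<qw)
              (solve (t ∷ n ∷ e ∷ f ∷ r ∷ vars))

mod-unique : ∀ {q s r} A B → s < q → r < q → s + A * q ≡ r + B * q → s ≡ r
mod-unique {suc q} {s} {r} A B s<q r<q eq = begin
  s                      ≡⟨ m<n⇒m%n≡m s<q ⟨
  s % suc q              ≡⟨ [m+kn]%n≡m%n s A (suc q) ⟨
  (s + A * suc q) % suc q ≡⟨ cong (_% suc q) eq ⟩
  (r + B * suc q) % suc q ≡⟨ [m+kn]%n≡m%n r B (suc q) ⟩
  r % suc q              ≡⟨ m<n⇒m%n≡m r<q ⟩
  r                      ∎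
  where open ≡-Reasoning

divide-from-1 : ∀ y {q} → 1 ≤ q → ∃ λ t → ∃ λ c → 1 ≤ t × t ≤ q × t + c * q ≡ y + q
divide-from-1 y {q@(suc q-1)} _ = suc (x % q) , x / q , s≤s z≤n , m%n<n x q , (begin
  suc (x % q + x / q * q)  ≡⟨ cong suc (m≡m%n+[m/n]*n x q) ⟨
  suc (y + q-1)            ≡⟨ +-suc y q-1 ⟨
  y + q                    ∎)
  where
  open ≡-Reasoning
  x = y + q-1

module Residues {m P Q q q′ p w w′ : ℕ} (L : IsLevel m P Q q q′ p w w′) where
  open IsLevel L
  open Level L

  -- From `q′ + p ≡ m * q` and `qq` the square of `p` is 1 modulo `q`, so `t` congruent to `s * p`
  -- gives `t * p` congruent to `s`. The level bounds identify the quotient with `f`.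
  residue-inverse : ∀ {s t f} c → s < q → t ≤ q → t + c * q ≡ s * p + q → IsFloor P Q f t →
                    t * p ≡ s + f * q
  residue-inverse {s} {t} {f} c s<q t≤q t-eq fl with m≤n⇒∃[o]m+o≡n (level-lower {f} {t} t≤q fl)
  ... | u , e = trans (sym e) (trans (+-comm (f * q) u) (cong (_+ f * q)
    (mod-unique (f + c * p + s * q) (s * (m * p) + p) u<q s<q identity)))
    where
    u<q : u < q
    u<q = +-cancelˡ-< (f * q) u q (subst₂ _<_ (sym e) (+-comm q (f * q)) (level-upper {f} {t} fl))
    identity : u + (f + c * p + s * q) * q ≡ s + (s * (m * p) + p) * q
    identity = linComb≡
      (cong₂ _+_ (cong (p *_) t-eq) (cong₂ _+_ (cong (s *_) qq) (cong₂ _+_ (cong (λ z → s * (p * z)) q′+p) e)))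
      (solve (m ∷ P ∷ Q ∷ q ∷ q′ ∷ p ∷ w ∷ w′ ∷ s ∷ t ∷ c ∷ f ∷ u ∷ []))

  -- p is its own inverse modulo q.
  abstract
    residue-exists : ∀ {s} → s < q → ∃ λ t → 1 ≤ t × t ≤ q ×
                     (∀ f → IsFloor P Q f t → t * p ≡ s + f * q)
    residue-exists {s} s<q with divide-from-1 (s * p) 1≤q
    ... | t , c , 1≤t , t≤q , t-eq = t , 1≤t , t≤q , λ f → residue-inverse {f = f} c s<q t≤q t-eq

-- V m k is U_{k−1}.
abstract
  V : ℕ → ℕ → ℕ
  V m zero = 0
  V m (suc zero) = 1
  V m (suc (suc k)) = m * V m (suc k) ∸ V m k

  U≡V : ∀ m k → U m k ≡ V m (suc k)
  U≡V m zero = refl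
  U≡V m (suc zero) = sym (*-identityʳ m)
  U≡V m (suc (suc k)) = cong₂ (λ x y → m * x ∸ y) (U≡V m (suc k)) (U≡V m k)

-- Growth and product identities of the recurrence

module Recurrence (m : ℕ) (3≤m : 3 ≤ m) where
  v = V m

  abstract
    V-double : ∀ k → 2 * v k ≤ v (suc k)
    V-rec : ∀ k → v (suc (suc k)) + v k ≡ m * v (suc k)

    V-double zero = z≤n
    V-double (suc k) = doubling m (v k) (v (suc k)) (v (suc (suc k))) 3≤m (V-double k) (V-rec k)
      where
      doubling : ∀ m x y z → 3 ≤ m → 2 * x ≤ y → z + x ≡ m * y → 2 * y ≤ z
      doubling m x y z h₁ h₂ h₃ = linComb≤ x (y ⊗ h₁ ⊕ h₂ ⊕ ≥eq h₃) (solve (m ∷ x ∷ y ∷ z ∷ []))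
    V-rec k = m∸n+n≡m (≤-trans (≤-trans (m≤m+n (v k) _) (V-double k))
      (m≤n*m (v (suc k)) m {{>-nonZero (≤-trans (s≤s z≤n) 3≤m)}}))

    V-mono : ∀ k → v k ≤ v (suc k)
    V-mono k = ≤-trans (m≤m+n (v k) _) (V-double k)

    V-pos : ∀ k → 1 ≤ v (suc k)
    V-pos zero = s≤s z≤n
    V-pos (suc k) = ≤-trans (V-pos k) (V-mono (suc k))

    d'Ocagne : ∀ i j → v (suc i) * v (j + i) ≡ v i * v (suc (j + i)) + v j
    d'Ocagne zero j = trans (+-identityʳ _) (cong v (+-identityʳ j))
    d'Ocagne (suc i) j rewrite +-suc j i =
      step m (v i) (v (suc i)) (v (suc (suc i))) (v (j + i)) (v (suc (j + i))) (v (suc (suc (j + i)))) (v j)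
        (V-rec i) (V-rec (j + i)) (d'Ocagne i j)
      where
      step : ∀ m x y z x′ y′ z′ w → z + x ≡ m * y → z′ + x′ ≡ m * y′ → y * x′ ≡ x * y′ + w →
             z * y′ ≡ y * z′ + w
      step m x y z x′ y′ z′ w h₁ h₂ h₃ = linComb≡
        (cong₂ _+_ (cong (y′ *_) h₁) (cong₂ _+_ (cong (y *_) (sym h₂)) h₃))
        (solve (m ∷ x ∷ y ∷ z ∷ x′ ∷ y′ ∷ z′ ∷ w ∷ []))

    V-square : ∀ i → v (suc i) * v (suc i) ≡ v i * v (suc (suc i)) + 1
    V-square i = d'Ocagne i 1

    V-add : ∀ i l → v (suc i) * v (suc l) ≡ v (suc (l + i)) + v i * v l
    V-add zero l = trans (+-identityʳ _) (trans (cong (λ z → v (suc z)) (sym (+-identityʳ l))) (sym (+-identityʳ _)))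
    V-add (suc i) l rewrite +-suc l i =
      step m (v i) (v (suc i)) (v (suc (suc i))) (v l) (v (suc l)) (v (suc (suc l))) (v (suc (suc (l + i))))
        (V-rec i) (V-rec l) (V-add i (suc l))
      where
      step : ∀ m x y z x′ y′ z′ w → z + x ≡ m * y → z′ + x′ ≡ m * y′ → y * z′ ≡ w + x * y′ →
             z * y′ ≡ w + y * x′
      step m x y z x′ y′ z′ w h₁ h₂ h₃ = linComb≡
        (cong₂ _+_ (cong (y′ *_) h₁) (cong₂ _+_ (cong (y *_) (sym h₂)) h₃))
        (solve (m ∷ x ∷ y ∷ z ∷ x′ ∷ y′ ∷ z′ ∷ w ∷ []))

    V-level : ∀ i l → IsLevel m (v (suc (l + i))) (v (suc (suc (l + i))))
                                (v (suc i)) (v (suc (suc i))) (v i) (v (suc l)) (v l)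
    V-level i l = record
      { qP = d'Ocagne i (suc l)
      ; q′P = subst (λ z → v (suc (suc i)) * v z ≡ v (suc i) * v (suc z) + v l) (+-suc l i) (d'Ocagne (suc i) l)
      ; q′w = subst (λ z → v (suc (suc i)) * v (suc l) ≡ v (suc z) + v (suc i) * v l) (+-suc l i) (V-add (suc i) l)
      ; qq = V-square i
      ; q′+p = V-rec i
      ; 1≤q = V-pos i
      ; 1≤w = V-pos l
      ; 2q≤q′ = V-double (suc i)
      ; 2w′≤w = V-double l
      }

-- Ranks of fractional parts

floor-unique : ∀ {P Q f g j} → IsFloor P Q f j → IsFloor P Q g j → f ≡ g
floor-unique {P} {Q} {f} {g} {j} (lo , hi) (lo′ , hi′) = ≤-antisym
  (s≤s⁻¹ (*-cancelʳ-< Q f (suc g) (≤-<-trans lo hi′)))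
  (s≤s⁻¹ (*-cancelʳ-< Q g (suc f) (≤-<-trans lo′ hi)))

sumBelow-cong : ∀ {f g : ℕ → ℕ} n → (∀ j → j < n → f j ≡ g j) → sumBelow f n ≡ sumBelow g n
sumBelow-cong zero e = refl
sumBelow-cong (suc n) e = cong₂ _+_ (sumBelow-cong n (λ j j<n → e j (m<n⇒m<1+n j<n))) (e n ≤-refl)

sumBelow-* : ∀ (f : ℕ → ℕ) c n → sumBelow f n * c ≡ sumBelow (λ j → f j * c) n
sumBelow-* f c zero = refl
sumBelow-* f c (suc n) = trans (*-distribʳ-+ c (sumBelow f n) (f n)) (cong (_+ f n * c) (sumBelow-* f c n))

sumBelow-+ : ∀ (f g : ℕ → ℕ) n → sumBelow f n + sumBelow g n ≡ sumBelow (λ j → f j + g j) n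
sumBelow-+ f g zero = refl
sumBelow-+ f g (suc n) = trans (interchange (sumBelow f n) (f n) (sumBelow g n) (g n))
  (cong (_+ (f n + g n)) (sumBelow-+ f g n))
  where
  interchange : ∀ a b c d → (a + b) + (c + d) ≡ (a + c) + (b + d)
  interchange = solve-∀

module Ranks (m : ℕ) (3≤m : 3 ≤ m) (K : ℕ) where
  open Recurrence m 3≤m public

  P = v (suc K)
  Q = v (suc (suc K))

  instance
    Q≢0 : NonZero Q
    Q≢0 = >-nonZero (V-pos (suc K))

  abstract
    level-at : ∀ {i} → i ≤ K →
      IsLevel m P Q (v (suc i)) (v (suc (suc i))) (v i) (v (suc (K ∸ i))) (v (K ∸ i))
    level-at {i} i≤K = subst
      (λ k → IsLevel m (v (suc k)) (v (suc (suc k))) (v (suc i)) (v (suc (suc i))) (v i) (v (suc (K ∸ i))) (v (K ∸ i)))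
      (m∸n+n≡m i≤K) (V-level i (K ∸ i))

  -- For j < Q this is ⌊jα⌋.
  abstract
    F : ℕ → ℕ
    F j = (j * P) / Q

    F-floor : ∀ j → IsFloor P Q (F j) j
    F-floor j = m/n*n≤m (j * P) Q , (begin-strict
      j * P                          ≡⟨ m≡m%n+[m/n]*n (j * P) Q ⟩
      j * P % Q + j * P / Q * Q      <⟨ +-monoˡ-< (j * P / Q * Q) (m%n<n (j * P) Q) ⟩
      suc (j * P / Q) * Q            ∎)
      where open ≤-Reasoning

  F-zero : F 0 ≡ 0
  F-zero = floor-unique {P} {Q} {j = 0} (F-floor 0) (z≤n , ≤-trans (V-pos (suc K)) (m≤m+n Q 0))

  F-shift : ∀ {i j} → i ≤ K → j + v (suc i) < v (suc (suc i)) → F (j + v (suc i)) ≡ F j + v i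
  F-shift {i} {j} i≤K lt = floor-unique {P} {Q} {j = j + v (suc i)} (F-floor _)
    (Level.floor-shift (level-at i≤K) {F j} {j} lt (F-floor j))

  infix 4 _≼_

  -- {tα} ≤ {nα}
  _≼_ : ℕ → ℕ → Set
  t ≼ n = t * P + F n * Q ≤ n * P + F t * Q

  record RankList (n : ℕ) (L : List ℕ) : Set where
    field
      unique   : Unique L
      sound    : ∀ {t} → t ∈ L → 1 ≤ t × t ≤ n × t ≼ n
      complete : ∀ {t} → 1 ≤ t → t ≤ n → t ≼ n → t ∈ L

  ranks-zero : RankList 0 []
  ranks-zero = record
    { unique = AllPairs.[] ; sound = λ () ; complete = λ 1≤t t≤0 _ → ⊥-elim (<⇒≱ 1≤t t≤0) }

  module Step {i : ℕ} (i≤K : i ≤ K) where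
    q = v (suc i)
    q′ = v (suc (suc i))
    p = v i
    open IsLevel (level-at i≤K)
    open Level (level-at i≤K) using (order⇐; order⇒; residue-injective; level-upper; level-lower)
    open Residues (level-at i≤K)

    HasResidue : ℕ → ℕ → Set
    HasResidue s t = t * p ≡ s + F t * q

    record ResiduesBelow (k : ℕ) (L : List ℕ) : Set where
      field
        unique   : Unique L
        sound    : ∀ {t} → t ∈ L → 1 ≤ t × t ≤ q × ∃ λ s → s < k × HasResidue s t
        complete : ∀ {t s} → 1 ≤ t → t ≤ q → s < k → HasResidue s t → t ∈ L

    -- One preimage is added per residue, so the length is known by construction and nothing is
    -- counted over `t`.
    residues-below : ∀ k → k ≤ q → ∃ λ L → ResiduesBelow k L × length L ≡ k
    residues-below zero _ = [] , record { unique = AllPairs.[] ; sound = λ () ; complete = λ _ _ () } , refl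
    residues-below (suc k) k<q
      with residues-below k (<⇒≤ k<q) | residue-exists k<q
    ... | L , B , len | t₀ , 1≤t₀ , t₀≤q , res = t₀ ∷ L , record
      { unique = All.tabulate (λ t∈L t₀≡t → fresh (subst (_∈ L) (sym t₀≡t) t∈L)) AllPairs.∷ unique
      ; sound = λ { (here refl) → 1≤t₀ , t₀≤q , k , ≤-refl , res (F t₀) (F-floor t₀)
                  ; (there t∈L) → let 1≤t , t≤q , s , s<k , e = sound t∈L
                                  in 1≤t , t≤q , s , m<n⇒m<1+n s<k , e }
      ; complete = λ 1≤t t≤q s<1+k e → comp 1≤t t≤q (m≤n⇒m<n∨m≡n (s≤s⁻¹ s<1+k)) e
      } , cong suc len
      where
      open ResiduesBelow B
      fresh : ¬ t₀ ∈ L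
      fresh t₀∈L with sound t₀∈L
      ... | _ , _ , s , s<k , e = <⇒≢ s<k
        (+-cancelʳ-≡ (F t₀ * q) s k (trans (sym e) (res (F t₀) (F-floor t₀))))
      comp : ∀ {t s} → 1 ≤ t → t ≤ q → s < k ⊎ s ≡ k → HasResidue s t → t ∈ t₀ ∷ L
      comp 1≤t t≤q (inj₁ s<k) e = there (complete 1≤t t≤q s<k e)
      comp {t} 1≤t t≤q (inj₂ refl) e = here (residue-injective {f = F t} {F t₀} k
        1≤t t≤q 1≤t₀ t₀≤q e (res (F t₀) (F-floor t₀)))

    residue-of : ∀ {t} → t ≤ q → ∃ λ s → HasResidue s t
    residue-of {t} t≤q with m≤n⇒∃[o]m+o≡n (level-lower {F t} {t} t≤q (F-floor t))
    ... | s , e = s , trans (sym e) (+-comm (F t * q) s)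

    abstract
      residue<q : ∀ {r n} → HasResidue r n → r < q
      residue<q {r} {n} e = +-cancelʳ-< (F n * q) r q
        (subst (_< suc (F n) * q) e (level-upper {F n} {n} (F-floor n)))

    module _ {n : ℕ} (n+q<q′ : n + q < q′) where

      F-n+q : F (n + q) ≡ F n + p
      F-n+q = F-shift {i} {n} i≤K n+q<q′

      residue-shift : ∀ {r} → HasResidue r n → HasResidue r (n + q)
      residue-shift {r} e = trans (identity n q p r (F n) e) (cong (λ z → r + z * q) (sym F-n+q))
        where
        identity : ∀ n q p r f → n * p ≡ r + f * q → (n + q) * p ≡ r + (f + p) * q
        identity n q p r f e = linComb≡ e (solve (n ∷ q ∷ p ∷ r ∷ f ∷ []))

      private
        ≼-identity : ∀ t g P Q q p → (t + q) * P + (g + p) * Q ≡ (t * P + g * Q) + (q * P + p * Q)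
        ≼-identity = solve-∀

      module _ {t : ℕ} (t≤n : t ≤ n) where
        private
          F-t+q : F (t + q) ≡ F t + p
          F-t+q = F-shift {i} {t} i≤K (≤-<-trans (+-monoˡ-≤ q t≤n) n+q<q′)

        ≼-shift⁺ : t ≼ n → t + q ≼ n + q
        ≼-shift⁺ t≼n rewrite F-n+q | F-t+q =
          subst₂ _≤_ (sym (≼-identity t (F n) P Q q p)) (sym (≼-identity n (F t) P Q q p))
            (+-monoˡ-≤ (q * P + p * Q) t≼n)

        ≼-shift⁻ : t + q ≼ n + q → t ≼ n
        ≼-shift⁻ t≼n rewrite F-n+q | F-t+q =
          +-cancelʳ-≤ (q * P + p * Q) _ _
            (subst₂ _≤_ (≼-identity t (F n) P Q q p) (≼-identity n (F t) P Q q p) t≼n)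

      ranks-step : ∀ {r L} → HasResidue r n → RankList n L →
                   ∃ λ L′ → RankList (n + q) L′ × length L′ ≡ suc r + length L
      ranks-step {r} {L} r-eq R with residues-below (suc r) (residue<q r-eq)
      ... | S , B , len = S ++ map (_+ q) L , record
        { unique = Unique.++⁺ B.unique (Unique.map⁺ (+-cancelʳ-≡ q _ _) R.unique) disjoint
        ; sound = λ t∈ → sound (∈-++⁻ S t∈)
        ; complete = λ {t} 1≤t t≤n+q t≼ → complete 1≤t t≤n+q t≼ (≤-<-connex t q)
        } , trans (length-++ S) (cong₂ _+_ len (length-map (_+ q) L))
        where
        module R = RankList R
        module B = ResiduesBelow B
        r-eq′ : HasResidue r (n + q)
        r-eq′ = residue-shift {r} r-eq
        disjoint : ∀ {t} → ¬ (t ∈ S × t ∈ map (_+ q) L)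
        disjoint (t∈S , t∈L) with ∈-map⁻ (_+ q) t∈L
        ... | u , u∈L , refl = <⇒≱ (+-monoˡ-≤ q (proj₁ (R.sound u∈L))) (proj₁ (proj₂ (B.sound t∈S)))
        sound : ∀ {t} → t ∈ S ⊎ t ∈ map (_+ q) L → 1 ≤ t × t ≤ n + q × t ≼ n + q
        sound {t} (inj₁ t∈S) with B.sound t∈S
        ... | 1≤t , t≤q , s , s<1+r , e = 1≤t , m≤n⇒m≤o+n n t≤q ,
          order⇐ {t} {n + q} {F (n + q)} {F t} {r} {s} e r-eq′ (s≤s⁻¹ s<1+r) (m≤n⇒m≤o+n n t≤q)
        sound (inj₂ t∈L) with ∈-map⁻ (_+ q) t∈L
        ... | u , u∈L , refl with R.sound u∈L
        ...   | 1≤u , u≤n , u≼n = m≤n⇒m≤n+o q 1≤u , +-monoˡ-≤ q u≤n , ≼-shift⁺ u≤n u≼n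
        complete : ∀ {t} → 1 ≤ t → t ≤ n + q → t ≼ n + q → t ≤ q ⊎ q < t → t ∈ S ++ map (_+ q) L
        complete {t} 1≤t _ t≼ (inj₁ t≤q) with residue-of t≤q
        ... | s , e = ∈-++⁺ˡ (B.complete 1≤t t≤q
          (s≤s (order⇒ {t} {n + q} {F (n + q)} {F t} {r} {s} e r-eq′ n+q<q′ t≼)) e)
        complete {t} 1≤t t≤n+q t≼ (inj₂ q<t) = subst (_∈ S ++ map (_+ q) L) u+q≡t
          (∈-++⁺ʳ S (∈-map⁺ (_+ q) (R.complete (m<n⇒0<n∸m q<t) u≤n
            (≼-shift⁻ u≤n (subst (_≼ n + q) (sym u+q≡t) t≼)))))
          where
          u+q≡t : t ∸ q + q ≡ t
          u+q≡t = m∸n+n≡m (<⇒≤ q<t)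
          u≤n : t ∸ q ≤ n
          u≤n = +-cancelʳ-≤ q (t ∸ q) n (subst (_≤ n + q) (sym u+q≡t) t≤n+q)

    ranks-steps : ∀ c {n r L} → n + c * q < q′ → HasResidue r n → RankList n L →
      (∃ λ L′ → RankList (n + c * q) L′ × length L′ ≡ c * suc r + length L) ×
      HasResidue r (n + c * q) × F (n + c * q) ≡ F n + c * p
    ranks-steps zero {n} {r} {L} _ e R rewrite +-identityʳ n = (L , R , refl) , e , sym (+-identityʳ (F n))
    ranks-steps (suc c) {n} {r} {L} lt e R
      with ranks-steps c {n} (≤-<-trans (+-monoʳ-≤ n (m≤n+m (c * q) q)) lt) e R
    ... | (L₁ , R₁ , len₁) , e₁ , F₁
      rewrite trans (cong (n +_) (+-comm q (c * q))) (sym (+-assoc n (c * q) q))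
      with ranks-step lt {r} e₁ R₁
    ... | L₂ , R₂ , len₂ = (L₂ , R₂ , trans len₂ (trans (cong (suc r +_) len₁) (sym (+-assoc (suc r) (c * suc r) (length L)))))
      , residue-shift lt {r} e₁
      , trans (F-n+q lt) (trans (cong (_+ p) F₁) (trans (+-assoc (F n) (c * p) p) (cong (F n +_) (+-comm (c * p) p))))

-- Expansions

module Expansion (m : ℕ) (3≤m : 3 ≤ m) (K : ℕ) (d : ℕ → ℕ) where
  open Ranks m 3≤m K

  value : ℕ → ℕ
  value i = sumBelow (λ k → d k * U m k) i

  shifted : ℕ → ℕ
  shifted i = sumBelow (λ k → d k * v k) i

  -- Each digit is handled by `d'Ocagne`. Once `F (value i)` is known to be `shifted i`, this says
  -- that `r m d i` is the residue of the truncated expansion at level `i`.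
  reversal : ∀ i → value i * v i ≡ r m d i + shifted i * v (suc i)
  reversal i = begin
    value i * v i
      ≡⟨ sumBelow-* (λ k → d k * U m k) (v i) i ⟩
    sumBelow (λ k → d k * U m k * v i) i
      ≡⟨ sumBelow-cong i term ⟩
    sumBelow (λ k → d k * U m (i ∸ 1 ∸ k) + d k * v k * v (suc i)) i
      ≡⟨ sumBelow-+ (λ k → d k * U m (i ∸ 1 ∸ k)) (λ k → d k * v k * v (suc i)) i ⟨
    r m d i + sumBelow (λ k → d k * v k * v (suc i)) i
      ≡⟨ cong (r m d i +_) (sumBelow-* (λ k → d k * v k) (v (suc i)) i) ⟨
    r m d i + shifted i * v (suc i) ∎
    where
    open ≡-Reasoning
    identity : ∀ d u x y z t → u * x ≡ y * z + t → d * u * x ≡ d * t + d * y * z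
    identity d u x y z t e = linComb≡ (cong (d *_) e) (solve (d ∷ u ∷ x ∷ y ∷ z ∷ t ∷ []))
    term : ∀ k → k < i → d k * U m k * v i ≡ d k * U m (i ∸ 1 ∸ k) + d k * v k * v (suc i)
    term k k<i with m≤n⇒∃[o]m+o≡n k<i
    ... | o , refl rewrite m+n∸m≡n k o | U≡V m k | U≡V m o =
      identity (d k) (v (suc k)) (v (suc k + o)) (v k) (v (suc (suc k + o))) (v (suc o))
        (subst (λ z → v (suc k) * v z ≡ v k * v (suc z) + v (suc o)) (cong suc (+-comm o k)) (d'Ocagne k (suc o)))

  extend : ∀ {i L} → i ≤ K → value (suc i) < U m (suc i) →
           RankList (value i) L → F (value i) ≡ shifted i →
           ∃ λ L′ → RankList (value (suc i)) L′ × length L′ ≡ d i * suc (r m d i) + length L ×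
                    F (value (suc i)) ≡ shifted (suc i)
  extend {i} {L} i≤K lt R Fi rewrite U≡V m i
    with Step.ranks-steps i≤K (d i) {value i} {r m d i} (subst (value i + d i * v (suc i) <_) (U≡V m (suc i)) lt)
         (trans (reversal i) (cong (λ z → r m d i + z * v (suc i)) (sym Fi))) R
  ... | (L′ , R′ , len) , _ , F′ = L′ , R′ , len , trans F′ (cong (_+ d i * v i) Fi)

  ranks-expansion : ∀ i → i ≤ K → (∀ j → j ≤ i → value (suc j) < U m (suc j)) →
    ∃ λ L → RankList (value (suc i)) L × length L ≡ formula m i d × F (value (suc i)) ≡ shifted (suc i)
  ranks-expansion zero 0≤K greedy with extend 0≤K (greedy 0 z≤n) ranks-zero F-zero
  ... | L , R , len , F₁ = L , R , trans len (trans (+-identityʳ _) (*-identityʳ _)) , F₁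
  ranks-expansion (suc i) i<K greedy
    with ranks-expansion i (<⇒≤ i<K) (λ j j≤i → greedy j (m≤n⇒m≤1+n j≤i))
  ... | L , R , len , F₁ with extend i<K (greedy (suc i) ≤-refl) R F₁
  ...   | L′ , R′ , len′ , F₂ = L′ , R′ ,
    trans len′ (trans (cong (d (suc i) * suc (r m d (suc i)) +_) len)
      (regroup (d (suc i)) (r m d (suc i)) (sumBelow (λ i → d (suc i) * (r m d (suc i) + 1)) i) (d 0))) , F₂
    where
    regroup : ∀ c r s e → c * suc r + (s + e) ≡ s + c * (r + 1) + e
    regroup = solve-∀

-- Rational comparison with α

-- With y = qm − 2p this is y² − q²(m² − 4) = 4(p² − mpq + q²), both sides moved
-- so that no subtraction occurs.
norm-identity : ∀ m D p q y → D + 4 ≡ m * m → y + 2 * p ≡ q * m →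
                q * q * D + 4 * (p * p + q * q) ≡ y * y + 4 * (m * (p * q))
norm-identity m D p q y e₁ e₂ = linComb≡
  (cong₂ _+_ (cong (q * q *_) e₁) (cong₂ _+_ (cong ((y + q * m) *_) (sym e₂)) (cong (2 * p *_) e₂)))
  (solve (m ∷ D ∷ p ∷ q ∷ y ∷ []))

module Slope (m : ℕ) (3≤m : 3 ≤ m) where

  -- p/q < α
  Below : ℕ → ℕ → Set
  Below p q = (2 * p < q * m) × (m * (p * q) < p * p + q * q)

  -- A negative norm means α < p/q < 1/α.
  Negative : ℕ → ℕ → Set
  Negative p q = p * p + q * q < m * (p * q)

  disc+4 : disc m + 4 ≡ m * m
  disc+4 = m∸n+n≡m (≤-trans (m≤m+n 4 5) (*-mono-≤ 3≤m 3≤m))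

  gap : ℕ → ℕ → ℕ
  gap p q = q * m ∸ 2 * p

  norm : ∀ {p q} → 2 * p ≤ q * m →
         q * q * disc m + 4 * (p * p + q * q) ≡ gap p q * gap p q + 4 * (m * (p * q))
  norm {p} {q} le = norm-identity m (disc m) p q (gap p q) disc+4 (m∸n+n≡m le)

  transfer : ∀ {w x y z} → w + 4 * y ≡ x + 4 * z → w < x → z < y
  transfer {w} {x} {y} {z} e w<x = *-cancelˡ-< 4 z y
    (linComb≤ 0 (w<x ⊕ ≥eq e) (solve (w ∷ x ∷ y ∷ z ∷ [])))

  transfer⁻ : ∀ {w x y z} → w + 4 * y ≡ x + 4 * z → z < y → w < x
  transfer⁻ {w} {x} {y} {z} e z<y =
    linComb≤ 3 (4 ⊗ z<y ⊕ ≤eq e) (solve (w ∷ x ∷ y ∷ z ∷ []))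

  ltα⇒Below : ∀ {p q} → T (ltα m p q) → Below p q
  ltα⇒Below {p} {q} t with Equivalence.to (T-∧ {2 * p <ᵇ q * m}) t
  ... | t₁ , t₂ = let lt = <ᵇ⇒< (2 * p) (q * m) t₁
                  in lt , transfer (norm {p} {q} (<⇒≤ lt)) (<ᵇ⇒< (q * q * disc m) (gap p q * gap p q) t₂)

  Below⇒ltα : ∀ {p q} → Below p q → T (ltα m p q)
  Below⇒ltα {p} {q} (lt , f) = Equivalence.from T-∧
    (<⇒<ᵇ lt , <⇒<ᵇ (transfer⁻ {q * q * disc m} {gap p q * gap p q} (norm {p} {q} (<⇒≤ lt)) f))

  gtα⇒ : ∀ {p q} → T (gtα m p q) → q * m < 2 * p ⊎ Negative p q
  gtα⇒ {p} {q} t with Equivalence.to (T-∨ {q * m <ᵇ 2 * p}) t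
  ... | inj₁ t₁ = inj₁ (<ᵇ⇒< (q * m) (2 * p) t₁)
  ... | inj₂ t₂ with ≤-<-connex (2 * p) (q * m)
  ...   | inj₁ le = inj₂ (transfer {gap p q * gap p q} (sym (norm {p} {q} le)) (<ᵇ⇒< (gap p q * gap p q) (q * q * disc m) t₂))
  ...   | inj₂ gt = inj₁ gt

  Below-pos : ∀ {p q} → Below p q → 1 ≤ q
  Below-pos {q = zero} (() , _)
  Below-pos {q = suc q} _ = s≤s z≤n

  -- The polynomial x² - mx + 1 decreases up to m/2, and `p / q` lies in that range with a positive
  -- value; a point to its left cannot have a negative value. The `δ` below is the cleared
  -- difference of the two fractions.
  Below<Negative : ∀ {p q A B} → Below p q → Negative A B → p * B < q * A
  Below<Negative {p} {q} {A} {B} β@(lt , f) g = ≰⇒> contra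
    where
    1≤q : 1 ≤ q
    1≤q = Below-pos {p} β
    contra : ¬ q * A ≤ p * B
    contra le with m≤n⇒∃[o]m+o≡n le
    ... | δ , e = linComb⊥ (B * B + δ * δ)
      (B * B ⊗ f ⊕ q * q ⊗ g ⊕ δ * B ⊗ <⇒≤ lt ⊕ m * (q * B) ⊗ ≤eq e
        ⊕ (p * B + q * A) ⊗ ≥eq e ⊕ δ ⊗ ≤eq e ⊕ *-mono-≤ 1≤q 1≤q)
      (solve (m ∷ p ∷ q ∷ A ∷ B ∷ δ ∷ []))

  Below-downward : ∀ {p j P Q} → p * Q < j * P → Below P Q → Below p j
  Below-downward {p} {j} {P} {Q} lt (lt′ , f) with m≤n⇒∃[o]m+o≡n (<⇒≤ lt)
  ... | δ , e = *-cancelˡ-< Q (2 * p) (j * m) (linComb≤ 1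
                  (2 ⊗ lt ⊕ j ⊗ <⇒≤ lt′) (solve (m ∷ p ∷ j ∷ P ∷ Q ∷ [])))
              , *-cancelˡ-< (Q * Q) (m * (p * j)) (p * p + j * j) (linComb≤ (δ * δ)
                  (j * j ⊗ f ⊕ δ * j ⊗ <⇒≤ lt′ ⊕ (p * Q + j * P) ⊗ ≥eq e ⊕ δ ⊗ ≤eq e
                    ⊕ m * (j * Q) ⊗ ≤eq e ⊕ *-mono-≤ 1≤j 1≤j)
                  (solve (m ∷ p ∷ j ∷ P ∷ Q ∷ δ ∷ [])))
    where
    1≤factor : ∀ {x j P} → x < j * P → 1 ≤ j
    1≤factor {j = suc j} _ = s≤s z≤n
    1≤j : 1 ≤ j
    1≤j = 1≤factor {P = P} lt

  Below<gtα : ∀ {p q P Q} → Below P Q → T (gtα m p q) → q * P < p * Q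
  Below<gtα {p} {q} {P} {Q} β t with gtα⇒ {p} {q} t
  ... | inj₁ lt = *-cancelˡ-< 2 (q * P) (p * Q) (linComb≤ 0
    (Q ⊗ lt ⊕ q ⊗ <⇒≤ (proj₁ β) ⊕ Below-pos {P} β) (solve (m ∷ p ∷ q ∷ P ∷ Q ∷ [])))
  ... | inj₂ neg = subst₂ _<_ (*-comm P q) (*-comm Q p) (Below<Negative {P} {Q} β neg)

  open Recurrence m 3≤m

  -- Consecutive terms give neighbours P/Q < α < A/B in the Farey sense AQ − PB = 1.
  record Neighbours (P Q A B : ℕ) : Set where
    field
      below : Below P Q
      above : Negative A B
      unimodular : A * Q ≡ P * B + 1
      2≤B : 2 ≤ B
      Q≤B : Q ≤ B

  -- With `R` the next term, `A = Q − P` and `B = R − Q`. Taking differences multiplies the norm by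
  -- 2 - m, so norm 1 turns into a negative norm, while the determinant becomes `Q * Q − P * R = 1`.
  neighbours-of : ∀ {P Q R} → 1 ≤ P → 2 * P ≤ Q → 2 * Q ≤ R → R + P ≡ m * Q → Q * Q ≡ P * R + 1 →
                  ∃ λ A → ∃ λ B → Neighbours P Q A B
  neighbours-of {P} {Q} {R} 1≤P 2P≤Q 2Q≤R R-eq square
    with m≤n⇒∃[o]m+o≡n (≤-trans (m≤m+n P _) 2P≤Q) | m≤n⇒∃[o]m+o≡n (≤-trans (m≤m+n Q _) 2Q≤R)
       | m≤n⇒∃[o]m+o≡n (≤-trans (s≤s (s≤s z≤n)) 3≤m)
  ... | A , A-eq | B , B-eq | m′ , m-eq = A , B , record
    { below = linComb≤ 3 (Q ⊗ 3≤m ⊕ 4 ⊗ 1≤P ⊕ 3 ⊗ 2P≤Q) (solve vars) , ≥eq (trans norm-one (+-comm _ 1))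
    ; above = above m m′ P Q R A B m-eq (s≤s⁻¹ (s≤s⁻¹ (subst (3 ≤_) (sym m-eq) 3≤m))) A-eq B-eq R-eq norm-one
    ; unimodular = linComb≡
        (cong₂ _+_ (cong (Q *_) A-eq) (cong₂ _+_ (cong (P *_) (sym B-eq)) square)) (solve vars)
    ; 2≤B = linComb≤ 0 (2 ⊗ 1≤P ⊕ 2P≤Q ⊕ 2Q≤R ⊕ ≥eq B-eq) (solve vars)
    ; Q≤B = linComb≤ 0 (2Q≤R ⊕ ≥eq B-eq) (solve vars)
    }
    where
    vars = m ∷ P ∷ Q ∷ R ∷ A ∷ B ∷ []
    norm-one : P * P + Q * Q ≡ m * (P * Q) + 1
    norm-one = linComb≡ (cong₂ _+_ (cong (P *_) R-eq) square) (solve vars)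
    above : ∀ m m′ P Q R A B → 2 + m′ ≡ m → 1 ≤ m′ → P + A ≡ Q → Q + B ≡ R → R + P ≡ m * Q →
            P * P + Q * Q ≡ m * (P * Q) + 1 → A * A + B * B < m * (A * B)
    above _ m′ P _ _ A B refl 1≤m′ refl refl e n with B-value
      where
      B-value : B ≡ A + m′ * (P + A)
      B-value = linComb≡ e (solve (m′ ∷ P ∷ A ∷ B ∷ []))
    ... | refl = linComb≤ 0 (m′ ⊗ ≥eq n ⊕ 1≤m′) (solve (m′ ∷ P ∷ A ∷ []))

  abstract
    neighbours : ∀ K → ∃ λ A → ∃ λ B → Neighbours (v (suc K)) (v (suc (suc K))) A B
    neighbours K = neighbours-of (V-pos K) (V-double (suc K)) (V-double (suc (suc K)))
      (V-rec (suc K)) (V-square (suc K))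

countBelow-⊓ : ∀ {P : ℕ → Bool} {c} n → (∀ k → k < n → T (P k) → k < c) → (∀ k → k < n → k < c → T (P k)) →
               countBelow P n ≡ n ⊓ c
countBelow-⊓ zero _ _ = refl
countBelow-⊓ {P} {c} (suc n) to from
  with P n | to n ≤-refl | from n ≤-refl
     | countBelow-⊓ {P} {c} n (λ k k<n → to k (m<n⇒m<1+n k<n)) (λ k k<n → from k (m<n⇒m<1+n k<n))
... | true | n<c | _ | ih rewrite ih | m≤n⇒m⊓n≡m (<⇒≤ (n<c _)) | m≤n⇒m⊓n≡m (n<c _) = +-comm n 1
... | false | _ | n≮c | ih with ≤-<-connex c n
...   | inj₁ c≤n rewrite ih | m≥n⇒m⊓n≡n c≤n | m≥n⇒m⊓n≡n (m≤n⇒m≤1+n c≤n) = +-identityʳ c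
...   | inj₂ n<c = ⊥-elim (n≮c n<c)

-- Factors of the Sturmian sequence

counta+countb : ∀ u → counta u + countb u ≡ length u
counta+countb [] = refl
counta+countb (a ∷ u) = cong suc (counta+countb u)
counta+countb (b ∷ u) = trans (+-suc (counta u) (countb u)) (cong suc (counta+countb u))

weight : Letter → ℕ
weight a = 0
weight b = 1

weight-injective : ∀ {l l′} → weight l ≡ weight l′ → l ≡ l′
weight-injective {a} {a} _ = refl
weight-injective {b} {b} _ = refl

countb-∷ : ∀ l u → countb (l ∷ u) ≡ weight l + countb u
countb-∷ a u = refl
countb-∷ b u = refl

module Factors (x : Seq) where

  factor-suc : ∀ i n → factorAt x i (suc n) ≡ x i ∷ factorAt x (suc i) n
  factor-suc i n = cong₂ _∷_ (cong x (+-identityʳ i)) (begin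
    map (λ j → x (i + j)) (applyUpTo suc n)       ≡⟨ cong (map _) (map-upTo suc n) ⟨
    map (λ j → x (i + j)) (map suc (upTo n))      ≡⟨ map-∘ (upTo n) ⟨
    map (λ j → x (i + suc j)) (upTo n)            ≡⟨ map-cong (λ j → cong x (+-suc i j)) (upTo n) ⟩
    map (λ j → x (suc i + j)) (upTo n)            ∎)
    where open ≡-Reasoning

  factor-length : ∀ i n → length (factorAt x i n) ≡ n
  factor-length i n = trans (length-map _ (upTo n)) (length-upTo n)

  bs : ℕ → ℕ → ℕ
  bs i n = countb (factorAt x i n)

  bs-suc : ∀ i n → bs i (suc n) ≡ weight (x i) + bs (suc i) n
  bs-suc i n = trans (cong countb (factor-suc i n)) (countb-∷ (x i) (factorAt x (suc i) n))

  bs-+ : ∀ i j k → bs i (j + k) ≡ bs i j + bs (i + j) k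
  bs-+ i zero k = cong (λ z → bs z k) (sym (+-identityʳ i))
  bs-+ i (suc j) k = begin
    bs i (suc (j + k))                                   ≡⟨ bs-suc i (j + k) ⟩
    weight (x i) + bs (suc i) (j + k)                    ≡⟨ cong (weight (x i) +_) (bs-+ (suc i) j k) ⟩
    weight (x i) + (bs (suc i) j + bs (suc i + j) k)     ≡⟨ +-assoc (weight (x i)) _ _ ⟨
    weight (x i) + bs (suc i) j + bs (suc i + j) k       ≡⟨ cong₂ _+_ (bs-suc i j) (cong (λ z → bs z k) (+-suc i j)) ⟨
    bs i (suc j) + bs (i + suc j) k                      ∎
    where open ≡-Reasoning

  factor-ext : ∀ i k n → (∀ j → j ≤ n → bs i j ≡ bs k j) → factorAt x i n ≡ factorAt x k n
  factor-ext i k zero e = refl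
  factor-ext i k (suc n) e = trans (factor-suc i n) (trans
    (cong₂ _∷_ head (factor-ext (suc i) (suc k) n λ j j≤n → +-cancelˡ-≡ (weight (x i)) _ _
      (trans (sym (bs-suc i j)) (trans (e (suc j) (s≤s j≤n))
        (trans (bs-suc k j) (cong (λ l → weight l + bs (suc k) j) (sym head)))))))
    (sym (factor-suc k n)))
    where
    head : x i ≡ x k
    head = weight-injective (+-cancelʳ-≡ 0 _ _ (trans (sym (bs-suc i 0)) (trans (e 1 (s≤s z≤n)) (bs-suc k 0))))

  factor-bs : ∀ i k n → factorAt x i n ≡ factorAt x k n → ∀ j → j ≤ n → bs i j ≡ bs k j
  factor-bs i k n e zero _ = refl
  factor-bs i k (suc n) e (suc j) (s≤s j≤n)
    with ∷-injective (trans (sym (factor-suc i n)) (trans e (factor-suc k n)))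
  ... | h , t = trans (bs-suc i j) (trans (cong₂ (λ l z → weight l + z) h (factor-bs (suc i) (suc k) n t j j≤n)) (sym (bs-suc k j)))

  bs-lower : ∀ j {f} → (∀ i → f ≤ bs i j) → ∀ k → k * f ≤ bs 0 (k * j)
  bs-lower j h zero = z≤n
  bs-lower j {f} h (suc k) = begin
    f + k * f                       ≡⟨ +-comm f (k * f) ⟩
    k * f + f                       ≤⟨ +-mono-≤ (bs-lower j h k) (h (k * j)) ⟩
    bs 0 (k * j) + bs (k * j) j     ≡⟨ bs-+ 0 (k * j) j ⟨
    bs 0 (k * j + j)                ≡⟨ cong (bs 0) (+-comm (k * j) j) ⟩
    bs 0 (j + k * j)                ∎
    where open ≤-Reasoning

  -- A disjunction, so that a block exceeding the average is found by search, without a classical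
  -- contrapositive.
  bs-upper : ∀ j f k → (∃ λ i → f < bs i j) ⊎ bs 0 (k * j) ≤ k * f
  bs-upper j f zero = inj₂ z≤n
  bs-upper j f (suc k) with bs-upper j f k | ≤-<-connex (bs (k * j) j) f
  ... | inj₁ found | _ = inj₁ found
  ... | inj₂ _ | inj₂ gt = inj₁ (k * j , gt)
  ... | inj₂ le | inj₁ le′ = inj₂ (begin
    bs 0 (j + k * j)                ≡⟨ cong (bs 0) (+-comm j (k * j)) ⟩
    bs 0 (k * j + j)                ≡⟨ bs-+ 0 (k * j) j ⟩
    bs 0 (k * j) + bs (k * j) j     ≤⟨ +-mono-≤ le le′ ⟩
    k * f + f                       ≡⟨ +-comm (k * f) f ⟩
    f + k * f                       ∎)
    where open ≤-Reasoning

-- Block counts and peaks of windows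

module Sturmian (m : ℕ) (3≤m : 3 ≤ m) (K : ℕ) (x : Seq)
                (balanced : Balanced x) (frequency : HasFrequencyα m x) where
  open Ranks m 3≤m K
  open Slope m 3≤m
  open Factors x

  A = proj₁ (neighbours K)
  B = proj₁ (proj₂ (neighbours K))
  open Neighbours (proj₂ (proj₂ (neighbours K)))

  -- Distinct fractions `f / j` and `P / Q` differ by at least `1 / (j * Q)`; taking this as ε, a
  -- prefix frequency above α - ε exceeds `f / j`.
  not-too-few : ∀ {j f} → 1 ≤ j → f * Q < j * P → ∃ λ k → ¬ bs 0 (k * j) ≤ k * f
  not-too-few {j} {f} 1≤j fQ<jP = suc M , contra
    where
    1≤jQ : 1 ≤ j * Q
    1≤jQ = *-mono-≤ 1≤j (V-pos (suc K))
    e = pred (j * Q)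
    e-eq : suc e ≡ j * Q
    e-eq = suc-pred (j * Q) {{>-nonZero 1≤jQ}}
    M = proj₁ (frequency e)
    identity : ∀ k c E j f P Q → suc (k * j * E * P) ≤ (c * E + k * j) * Q → c ≤ k * f → f * Q < j * P → E ≡ j * Q → 1 ≤ k → ⊥
    identity k c E j f P Q h₁ h₂ h₃ h₄ h₅ = linComb⊥ 0
      (h₁ ⊕ E * Q ⊗ h₂ ⊕ k * E ⊗ h₃ ⊕ k ⊗ ≥eq h₄) (solve (k ∷ c ∷ E ∷ j ∷ f ∷ P ∷ Q ∷ []))
    contra : ¬ bs 0 (suc M * j) ≤ suc M * f
    contra le = identity (suc M) (bs 0 (suc M * j)) (suc e) j f P Q
      (Below<gtα {bs 0 (suc M * j) * suc e + suc M * j} {suc M * j * suc e} {P} {Q} below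
        (proj₂ (proj₂ (frequency e) (suc M * j)
        (≤-trans (n≤1+n M) (m≤m*n (suc M) j {{>-nonZero 1≤j}}))
        (*-mono-≤ (s≤s (z≤n {M})) 1≤j))))
      le fQ<jP e-eq (s≤s z≤n)

  -- Since α may exceed `P / Q`, the comparison goes through `A / B`: a fraction above `P / Q` with
  -- denominator `j < Q` is also above `A / B`, by at least the chosen ε, `1 / (j * B)`.
  not-too-many : ∀ {j f} → 1 ≤ j → j < Q → j * P < f * Q → ∃ λ k → ¬ k * f ≤ bs 0 (k * j)
  not-too-many {j} {f} 1≤j j<Q jP<fQ = suc M , contra
    where
    1≤jB : 1 ≤ j * B
    1≤jB = *-mono-≤ 1≤j (≤-trans (s≤s z≤n) 2≤B)
    e = pred (j * B)
    e-eq : suc e ≡ j * B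
    e-eq = suc-pred (j * B) {{>-nonZero 1≤jB}}
    M = proj₁ (frequency e)
    1≤Mj : 1 ≤ suc M * j
    1≤Mj = *-mono-≤ (s≤s (z≤n {M})) 1≤j
    separate : ∀ j f P Q A B → j * P < f * Q → A * Q ≡ P * B + 1 → j < Q → Q ≤ B → j * A < f * B
    separate j f P Q A B h₁ h₂ h₃ h₄ = ≰⇒> λ (le : f * B ≤ j * A) → linComb⊥ 0
      (B ⊗ h₁ ⊕ Q ⊗ le ⊕ j ⊗ ≤eq h₂ ⊕ h₃ ⊕ h₄) (solve (j ∷ f ∷ P ∷ Q ∷ A ∷ B ∷ []))
    positive : ∀ {y f} → y < f * Q → 1 ≤ f
    positive {f = suc f} _ = s≤s z≤n
    few : ∀ k c E j f B → c * E ≤ k * j → k * f ≤ c → E ≡ j * B → 1 ≤ f → 2 ≤ B → 1 ≤ k * j → ⊥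
    few k c E j f B h₁ h₂ h₃ h₄ h₅ h₆ = linComb⊥ 0
      (h₁ ⊕ E ⊗ h₂ ⊕ k * E ⊗ h₄ ⊕ k ⊗ ≥eq h₃ ⊕ k * j ⊗ h₅ ⊕ h₆) (solve (k ∷ c ∷ E ∷ j ∷ f ∷ B ∷ []))
    many : ∀ k c E j f A B z → suc (z * B) ≤ k * j * E * A → c * E ≤ k * j + z → k * f ≤ c → E ≡ j * B → j * A < f * B → ⊥
    many k c E j f A B z h₁ h₂ h₃ h₄ h₅ = linComb⊥ 0
      (h₁ ⊕ B ⊗ h₂ ⊕ E * B ⊗ h₃ ⊕ k * E ⊗ h₅ ⊕ k ⊗ ≥eq h₄) (solve (k ∷ c ∷ E ∷ j ∷ f ∷ A ∷ B ∷ z ∷ []))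
    contra : ¬ suc M * f ≤ bs 0 (suc M * j)
    contra le with proj₁ (proj₂ (frequency e) (suc M * j)
        (≤-trans (n≤1+n M) (m≤m*n (suc M) j {{>-nonZero 1≤j}})) 1≤Mj)
    -- The branch where frequency minus ε is not positive: it would force `f * B ≤ 1`.
    ... | inj₁ h = few (suc M) (bs 0 (suc M * j)) (suc e) j f B h le e-eq (positive jP<fQ) 2≤B 1≤Mj
    ... | inj₂ h = many (suc M) (bs 0 (suc M * j)) (suc e) j f A B (bs 0 (suc M * j) * suc e ∸ suc M * j)
      (Below<Negative {bs 0 (suc M * j) * suc e ∸ suc M * j} {suc M * j * suc e} {A} {B}
        (ltα⇒Below {bs 0 (suc M * j) * suc e ∸ suc M * j} {suc M * j * suc e} h) above)
      (m≤n+m∸n (bs 0 (suc M * j) * suc e) (suc M * j)) le e-eq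
      (separate j f P Q A B jP<fQ unimodular j<Q Q≤B)

  F-strict : ∀ {j} → 1 ≤ j → j < Q → F j * Q < j * P
  F-strict {j} 1≤j j<Q = ≤∧≢⇒< (proj₁ (F-floor j)) (multiple-free {P} {Q} {f = F j} (V-square (suc K)) 1≤j j<Q)

  -- A block with two more than `F j` would, by balance, push every block of length `j` above `F j`,
  -- contradicting the frequency. `F≤bs` is the mirror image.
  bs≤ : ∀ i {j} → 1 ≤ j → j < Q → bs i j ≤ suc (F j)
  bs≤ i {j} 1≤j j<Q = ≮⇒≥ λ gt →
    let k , no = not-too-many 1≤j j<Q (proj₂ (F-floor j))
    in no (bs-lower j (λ i′ → s≤s⁻¹ (≤-trans gt (balanced i i′ j))) k)

  F≤bs : ∀ i {j} → 1 ≤ j → j < Q → F j ≤ bs i j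
  F≤bs i {j} 1≤j j<Q = ≮⇒≥ (clash (not-too-few 1≤j (F-strict 1≤j j<Q)))
    where
    clash : (∃ λ k → ¬ bs 0 (k * j) ≤ k * F j) → ¬ bs i j < F j
    clash (k , no) lt with bs-upper j (F j) k
    ... | inj₂ le = no le
    ... | inj₁ (i′ , gt) = <⇒≱ (≤-trans gt (balanced i′ i j)) lt

  2P≤Q : 2 * P ≤ Q
  2P≤Q = V-double (suc K)

  P<Q : P < Q
  P<Q = linear P Q 2P≤Q (V-pos K)
    where
    linear : ∀ P Q → 2 * P ≤ Q → 1 ≤ P → P < Q
    linear P Q h₁ h₂ = linComb≤ 0 (h₁ ⊕ h₂) (solve (P ∷ Q ∷ []))

  F-P+ : ∀ {j} → j < P → F (j + P) ≡ F j + v K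
  F-P+ {j} j<P = F-shift {K} {j} ≤-refl (<-≤-trans (+-monoˡ-< P j<P) (linear P Q 2P≤Q))
    where
    linear : ∀ P Q → 2 * P ≤ Q → P + P ≤ Q
    linear P Q h = linComb≤ 0 h (solve (P ∷ Q ∷ []))

  F-P : F P ≡ v K
  F-P = trans (F-P+ (V-pos K)) (cong (_+ v K) F-zero)

  abstract
    rich : ∃ λ s → v K < bs s P
    rich = search (not-too-few (V-pos K) (subst (λ z → z * Q < P * P) F-P (F-strict (V-pos K) P<Q)))
      where
      search : (∃ λ k → ¬ bs 0 (k * P) ≤ k * v K) → ∃ λ s → v K < bs s P
      search (k , no) with bs-upper P (v K) k
      ... | inj₁ found = found
      ... | inj₂ le = ⊥-elim (no le)

  -- Of the two possible counts, every block of the window starting at offset `t` has the smaller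
  -- and every nonempty block ending there the larger: the discrete form of a maximum at `t`.
  record Peak (i t n : ℕ) : Set where
    field
      after  : ∀ j → t + j ≤ n → bs (i + t) j ≡ F j
      before : ∀ j k → j + k ≡ t → 1 ≤ k → bs (i + j) k ≡ suc (F k)

  -- A block with one more b than the convergent predicts climbs to within
  -- ‖Pα‖ of the supremum of |x₀…x_{c−1}|_b − cα, and no shift shorter than P
  -- can close that gap.
  centre : ℕ
  centre = proj₁ rich + P

  -- The block of length `P` before `centre` already carries the whole surplus allowed to its
  -- extension by `j`.
  centre-after : ∀ j → j < P → bs centre j ≡ F j
  centre-after zero _ = sym F-zero
  centre-after (suc j) j<P = ≤-antisym
    (+-cancelˡ-≤ (suc (v K)) _ _ (begin
      suc (v K) + bs centre (suc j)              ≤⟨ +-monoˡ-≤ _ (proj₂ rich) ⟩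
      bs s P + bs (s + P) (suc j)                ≡⟨ bs-+ s P (suc j) ⟨
      bs s (P + suc j)                           ≤⟨ bs≤ s (≤-trans (V-pos K) (m≤m+n P _)) P+j<Q ⟩
      suc (F (P + suc j))                        ≡⟨ cong (λ z → suc (F z)) (+-comm P (suc j)) ⟩
      suc (F (suc j + P))                        ≡⟨ cong suc (F-P+ j<P) ⟩
      suc (F (suc j) + v K)                      ≡⟨ cong suc (+-comm (F (suc j)) (v K)) ⟩
      suc (v K) + F (suc j)                      ∎))
    (F≤bs centre (s≤s z≤n) (<-trans j<P P<Q))
    where
    open ≤-Reasoning
    s = proj₁ rich
    linear : ∀ P Q j → 2 * P ≤ Q → suc j < P → P + suc j < Q
    linear P Q j h₁ h₂ = linComb≤ 0 (h₁ ⊕ h₂) (solve (P ∷ Q ∷ j ∷ []))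
    P+j<Q : P + suc j < Q
    P+j<Q = linear P Q j 2P≤Q j<P

  -- The rich block is cut in two. By `floor-complement` its count is at least the sum of the maxima
  -- of both parts, so the right part attains its maximum.
  centre-before : ∀ i k → i + k ≡ centre → 1 ≤ k → k < P → bs i k ≡ suc (F k)
  centre-before i k i+k≡c 1≤k k<P with m≤n⇒∃[o]m+o≡n k<P
  ... | o , k+o≡P = ≤-antisym (bs≤ i 1≤k (<-trans k<P P<Q))
    (+-cancelˡ-≤ (suc (F (suc o))) _ _ (begin
      suc (F (suc o)) + suc (F k)         ≡⟨ +-suc (suc (F (suc o))) (F k) ⟩
      suc (suc (F (suc o) + F k))         ≡⟨ cong suc (Level.floor-complement (level-at {K} ≤-refl)
                                              {F (suc o)} {F k} {suc o} {k} (s≤s z≤n) 1≤k o+k≡P (F-floor (suc o)) (F-floor k)) ⟩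
      suc (v K)                           ≤⟨ proj₂ rich ⟩
      bs s P                              ≡⟨ cong (bs s) o+k≡P ⟨
      bs s (suc o + k)                    ≡⟨ bs-+ s (suc o) k ⟩
      bs s (suc o) + bs (s + suc o) k     ≡⟨ cong (λ z → bs s (suc o) + bs z k) position ⟩
      bs s (suc o) + bs i k               ≤⟨ +-monoˡ-≤ (bs i k) (bs≤ s (s≤s z≤n) o<Q) ⟩
      suc (F (suc o)) + bs i k            ∎))
    where
    open ≤-Reasoning
    s = proj₁ rich
    o+k≡P : suc o + k ≡ P
    o+k≡P = trans (cong suc (+-comm o k)) k+o≡P
    o<Q : suc o < Q
    o<Q = ≤-<-trans (subst (suc o ≤_) o+k≡P (m≤m+n (suc o) k)) P<Q
    position : s + suc o ≡ i
    position = +-cancelʳ-≡ k _ _ (trans (+-assoc s (suc o) k) (trans (cong (s +_) o+k≡P) (sym i+k≡c)))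

  P≤centre : P ≤ centre
  P≤centre = m≤n+m P (proj₁ rich)

  module _ {n : ℕ} (n<P : n < P) where

    peak-centre : ∀ {t} → t ≤ n → Peak (centre ∸ t) t n
    peak-centre {t} t≤n = record
      { after = λ j t+j≤n → trans (cong (λ z → bs z j) at-centre)
                  (centre-after j (≤-<-trans (≤-trans (m≤n+m j t) t+j≤n) n<P))
      ; before = λ j k j+k≡t 1≤k → centre-before (centre ∸ t + j) k
                  (trans (+-assoc (centre ∸ t) j k) (trans (cong (centre ∸ t +_) j+k≡t) at-centre)) 1≤k
                  (≤-<-trans (≤-trans (subst (k ≤_) j+k≡t (m≤n+m k j)) t≤n) n<P)
      }
      where
      at-centre : centre ∸ t + t ≡ centre
      at-centre = m∸n+n≡m (≤-trans t≤n (≤-trans (<⇒≤ n<P) P≤centre))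

  argmax : ∀ (g : ℕ → ℕ) n → ∃ λ t → t ≤ n × (∀ j → j ≤ n → g j ≤ g t)
  argmax g zero = 0 , z≤n , λ { zero z≤n → ≤-refl }
  argmax g (suc n) with argmax g n
  ... | t , t≤n , max with ≤-total (g (suc n)) (g t)
  ...   | inj₁ le = t , m≤n⇒m≤1+n t≤n , bound
    where
    bound : ∀ j → j ≤ suc n → g j ≤ g t
    bound j j≤1+n with m≤n⇒m<n∨m≡n j≤1+n
    ... | inj₁ j<1+n = max j (s≤s⁻¹ j<1+n)
    ... | inj₂ refl = le
  ...   | inj₂ le = suc n , ≤-refl , bound
    where
    bound : ∀ j → j ≤ suc n → g j ≤ g (suc n)
    bound j j≤1+n with m≤n⇒m<n∨m≡n j≤1+n
    ... | inj₁ j<1+n = ≤-trans (max j (s≤s⁻¹ j<1+n)) le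
    ... | inj₂ refl = ≤-refl

  -- The peak of a factor maximises |x_i…x_{i+j−1}|_b − jα.
  peak-exists : ∀ i n → n < Q → ∃ λ t → t ≤ n × Peak i t n
  peak-exists i n n<Q with argmax (λ j → bs i j * Q + (n ∸ j) * P) n
  ... | t , t≤n , max = t , t≤n , record { after = after ; before = before }
    where
    after : ∀ j → t + j ≤ n → bs (i + t) j ≡ F j
    after zero _ = sym F-zero
    after j@(suc _) t+j≤n with m≤n⇒∃[o]m+o≡n t+j≤n
    ... | o , refl = ≤-antisym (s≤s⁻¹ (*-cancelʳ-< Q _ _ (≤-<-trans small (proj₂ (F-floor j)))))
                               (F≤bs (i + t) (s≤s z≤n) (≤-<-trans (≤-trans (m≤n+m j t) t+j≤n) n<Q))
      where
      go : ∀ c c′ j o P Q → (c + c′) * Q + o * P ≤ c * Q + (j + o) * P → c′ * Q ≤ j * P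
      go c c′ j o P Q h = linComb≤ 0 h (solve (c ∷ c′ ∷ j ∷ o ∷ P ∷ Q ∷ []))
      small : bs (i + t) j * Q ≤ j * P
      small = go (bs i t) (bs (i + t) j) j o P Q (subst₂ _≤_
        (cong₂ (λ y z → y * Q + z * P) (bs-+ i t j) (m+n∸m≡n (t + j) o))
        (cong (λ z → bs i t * Q + z * P) (trans (cong (_∸ t) (+-assoc t j o)) (m+n∸m≡n t (j + o))))
        (max (t + j) t+j≤n))
    before : ∀ j k → j + k ≡ t → 1 ≤ k → bs (i + j) k ≡ suc (F k)
    before j k refl 1≤k with m≤n⇒∃[o]m+o≡n t≤n
    -- Maximality gives only `k * P ≤ bs (i + j) k * Q`; the strict `F k * Q < k * P` turns this
    -- into one more than `F k`.
    ... | o , refl = ≤-antisym (bs≤ (i + j) 1≤k k<Q) (*-cancelʳ-< Q _ _ (<-≤-trans (F-strict 1≤k k<Q) large))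
      where
      k<Q : k < Q
      k<Q = ≤-<-trans (≤-trans (m≤n+m k j) t≤n) n<Q
      go : ∀ c c′ k o P Q → c * Q + (k + o) * P ≤ (c + c′) * Q + o * P → k * P ≤ c′ * Q
      go c c′ k o P Q h = linComb≤ 0 h (solve (c ∷ c′ ∷ k ∷ o ∷ P ∷ Q ∷ []))
      large : k * P ≤ bs (i + j) k * Q
      large = go (bs i j) (bs (i + j) k) k o P Q (subst₂ _≤_
        (cong (λ z → bs i j * Q + z * P) (trans (cong (_∸ j) (+-assoc j k o)) (m+n∸m≡n j (k + o))))
        (cong₂ (λ y z → y * Q + z * P) (bs-+ i j k) (m+n∸m≡n (j + k) o))
        (max j (≤-trans (m≤m+n j k) t≤n)))

  peak-before : ∀ {i t n} → Peak i t n → 1 ≤ t → bs i t ≡ suc (F t)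
  peak-before {i} {t} p 1≤t = trans (cong (λ z → bs z t) (sym (+-identityʳ i))) (Peak.before p 0 t refl 1≤t)

  peak-count : ∀ {i t k} → Peak i t (t + k) → 1 ≤ t → bs i (t + k) ≡ suc (F t + F k)
  peak-count {i} {t} {k} p 1≤t = trans (bs-+ i t k) (cong₂ _+_ (peak-before p 1≤t) (Peak.after p k ≤-refl))

  peak-factor : ∀ {i i′ t n} → Peak i t n → Peak i′ t n → 1 ≤ t → factorAt x i n ≡ factorAt x i′ n
  peak-factor {i} {i′} {t} {n} p p′ 1≤t = factor-ext i i′ n same
    where
    module p = Peak p
    module p′ = Peak p′
    top : bs i t ≡ bs i′ t
    top = trans (peak-before p 1≤t) (sym (peak-before p′ 1≤t))
    same : ∀ j → j ≤ n → bs i j ≡ bs i′ j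
    same j j≤n with ≤-<-connex t j
    ... | inj₁ t≤j with m≤n⇒∃[o]m+o≡n t≤j
    ...   | k , refl = trans (bs-+ i t k) (trans
            (cong₂ _+_ top (trans (p.after k j≤n) (sym (p′.after k j≤n)))) (sym (bs-+ i′ t k)))
    same j j≤n | inj₂ j<t with m≤n⇒∃[o]m+o≡n j<t
    ...   | k , e = +-cancelʳ-≡ (bs (i + j) (suc k)) _ _ (begin
            bs i j + bs (i + j) (suc k)         ≡⟨ bs-+ i j (suc k) ⟨
            bs i (j + suc k)                    ≡⟨ cong (bs i) j+k≡t ⟩
            bs i t                              ≡⟨ top ⟩
            bs i′ t                             ≡⟨ cong (bs i′) j+k≡t ⟨
            bs i′ (j + suc k)                   ≡⟨ bs-+ i′ j (suc k) ⟩
            bs i′ j + bs (i′ + j) (suc k)       ≡⟨ cong (bs i′ j +_) (trans (p′.before j (suc k) j+k≡t (s≤s z≤n))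
                                                     (sym (p.before j (suc k) j+k≡t (s≤s z≤n)))) ⟩
            bs i′ j + bs (i + j) (suc k)        ∎)
      where
      open ≡-Reasoning
      j+k≡t : j + suc k ≡ t
      j+k≡t = trans (+-suc j k) e

  -- The block between two different peaks would follow one and precede the other, hence have both
  -- possible counts.
  peak-injective : ∀ {i i′ t t′ n} → t ≤ n → t′ ≤ n → Peak i t n → Peak i′ t′ n →
                   factorAt x i n ≡ factorAt x i′ n → t ≡ t′
  peak-injective t≤n t′≤n p p′ e = ≤-antisym (≮⇒≥ (earlier t≤n p′ p (sym e))) (≮⇒≥ (earlier t′≤n p p′ e))
    where
    earlier : ∀ {i i′ t t′ n} → t′ ≤ n → Peak i t n → Peak i′ t′ n → factorAt x i n ≡ factorAt x i′ n → ¬ t < t′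
    earlier {i} {i′} {t} {t′} {n} t′≤n p p′ e t<t′ with m≤n⇒∃[o]m+o≡n t<t′
    ... | k , refl = 1+n≢n (begin
      suc (F (suc k))          ≡⟨ Peak.before p′ t (suc k) (+-suc t k) (s≤s z≤n) ⟨
      bs (i′ + t) (suc k)      ≡⟨ +-cancelˡ-≡ (bs i t) _ _ (begin
        bs i t + bs (i + t) (suc k)      ≡⟨ bs-+ i t (suc k) ⟨
        bs i (t + suc k)                 ≡⟨ factor-bs i i′ n e (t + suc k) t+k≤n ⟩
        bs i′ (t + suc k)                ≡⟨ bs-+ i′ t (suc k) ⟩
        bs i′ t + bs (i′ + t) (suc k)    ≡⟨ cong (_+ bs (i′ + t) (suc k)) (factor-bs i i′ n e t (≤-trans (m≤m+n t _) t+k≤n)) ⟨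
        bs i t + bs (i′ + t) (suc k)     ∎) ⟨
      bs (i + t) (suc k)       ≡⟨ Peak.after p (suc k) t+k≤n ⟩
      F (suc k)                ∎)
      where
      open ≡-Reasoning
      t+k≤n : t + suc k ≤ n
      t+k≤n = subst (_≤ n) (sym (+-suc t k)) t′≤n

-- Counting

unique-map : ∀ {A B : Set} (f : A → B) {L} → (∀ {s t} → s ∈ L → t ∈ L → f s ≡ f t → s ≡ t) →
             Unique L → Unique (map f L)
unique-map f inj AllPairs.[] = AllPairs.[]
unique-map f inj (s∉L AllPairs.∷ u) =
  All.map⁺ (All.tabulate λ t∈L e → All.lookup s∉L t∈L (inj (here refl) (there t∈L) e))
  AllPairs.∷ unique-map f (λ s∈L t∈L → inj (there s∈L) (there t∈L)) u

T-not⁺ : ∀ {β} → ¬ T β → T (not β)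
T-not⁺ {false} _ = _
T-not⁺ {true} no = no _

T-not⁻ : ∀ {β} → T (not β) → ¬ T β
T-not⁻ {false} _ ()

module Counting (m : ℕ) (3≤m : 3 ≤ m) (K : ℕ) (x : Seq)
                (balanced : Balanced x) (frequency : HasFrequencyα m x) where
  open Ranks m 3≤m K
  open Slope m 3≤m
  open Factors x
  open Sturmian m 3≤m K x balanced frequency
  open Neighbours (proj₂ (proj₂ (neighbours K)))

  -- The order says that adding the fractional parts of `t` and `k` produces no carry.
  ≼⇒F-+ : ∀ t k → t ≼ t + k → F t + F k ≡ F (t + k)
  ≼⇒F-+ t k le = ≤-antisym
    (s≤s⁻¹ (*-cancelʳ-< Q _ _ (superadditive t k P Q (F t) (F k) (F (t + k))
      (proj₁ (F-floor t)) (proj₁ (F-floor k)) (proj₂ (F-floor (t + k))))))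
    (s≤s⁻¹ (*-cancelʳ-< Q _ _ (subadditive t k P Q (F t) (F k) (F (t + k)) le (proj₂ (F-floor k)))))
    where
    superadditive : ∀ t k P Q f g e → f * Q ≤ t * P → g * Q ≤ k * P → (t + k) * P < suc e * Q →
                    (f + g) * Q < suc e * Q
    superadditive t k P Q f g e h₁ h₂ h₃ = linComb≤ 0 (h₁ ⊕ h₂ ⊕ h₃) (solve (t ∷ k ∷ P ∷ Q ∷ f ∷ g ∷ e ∷ []))
    subadditive : ∀ t k P Q f g e → t * P + e * Q ≤ (t + k) * P + f * Q → k * P < suc g * Q →
                  e * Q < suc (f + g) * Q
    subadditive t k P Q f g e h₁ h₂ = linComb≤ 0 (h₁ ⊕ h₂) (solve (t ∷ k ∷ P ∷ Q ∷ f ∷ g ∷ e ∷ []))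

  F-+⇒≼ : ∀ t k → F t + F k ≡ F (t + k) → t ≼ t + k
  F-+⇒≼ t k e = identity t k P Q (F t) (F k) (F (t + k)) e (proj₁ (F-floor k))
    where
    identity : ∀ t k P Q f g e → f + g ≡ e → g * Q ≤ k * P → t * P + e * Q ≤ (t + k) * P + f * Q
    identity t k P Q f g e h₁ h₂ = linComb≤ 0 (Q ⊗ ≥eq h₁ ⊕ h₂) (solve (t ∷ k ∷ P ∷ Q ∷ f ∷ g ∷ e ∷ []))

  module _ {n : ℕ} (1≤n : 1 ≤ n) (n<P : n < P) where

    n<Q : n < Q
    n<Q = <-trans n<P P<Q

    F<n : F n < n
    F<n = *-cancelʳ-< Q (F n) n (<-≤-trans (F-strict 1≤n n<Q) (*-monoʳ-≤ n (<⇒≤ P<Q)))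

    ltα⇒<F : ∀ q → T (ltα m q n) → q < suc (F n)
    ltα⇒<F q t = *-cancelʳ-< Q q (suc (F n)) (<-trans
      (separate q n P Q A B (Below<Negative {q} {n} {A} {B} (ltα⇒Below {q} {n} t) above) unimodular n<Q)
      (proj₂ (F-floor n)))
      where
      separate : ∀ q n P Q A B → q * B < n * A → A * Q ≡ P * B + 1 → n < Q → q * Q < n * P
      separate q n P Q A B h₁ h₂ h₃ = ≰⇒> λ (le : n * P ≤ q * Q) → linComb⊥ 0
        (Q ⊗ h₁ ⊕ B ⊗ le ⊕ n ⊗ ≤eq h₂ ⊕ h₃) (solve (q ∷ n ∷ P ∷ Q ∷ A ∷ B ∷ []))

    <F⇒ltα : ∀ q → q < suc (F n) → T (ltα m q n)
    <F⇒ltα q q≤F = Below⇒ltα {q} {n} (Below-downward {q} {n} {P} {Q}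
      (≤-<-trans (*-monoˡ-≤ Q (s≤s⁻¹ q≤F)) (F-strict 1≤n n<Q)) below)

    ceil≡ : ceilNα m n ≡ suc (F n)
    ceil≡ = trans (countBelow-⊓ (suc n) (λ q _ → ltα⇒<F q) (λ q _ → <F⇒ltα q))
                  (m≥n⇒m⊓n≡n (m≤n⇒m≤1+n F<n))

    floor≡ : floorN1mα m n ≡ n ∸ suc (F n)
    floor≡ = trans (countBelow-⊓ n to from) (m≥n⇒m⊓n≡n (m∸n≤m n (suc (F n))))
      where
      to : ∀ q → q < n → T (not (ltα m (n ∸ suc q) n)) → q < n ∸ suc (F n)
      to q q<n t = m+n≤o⇒m≤o∸n (suc q) (subst (_≤ n) (+-comm (suc (F n)) (suc q))
        (≤-trans (+-monoˡ-≤ (suc q) (≮⇒≥ λ lt → T-not⁻ {ltα m (n ∸ suc q) n} t (<F⇒ltα (n ∸ suc q) lt)))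
          (≤-reflexive (m∸n+n≡m q<n))))
      from : ∀ q → q < n → q < n ∸ suc (F n) → T (not (ltα m (n ∸ suc q) n))
      from q q<n lt = T-not⁺ {ltα m (n ∸ suc q) n} λ t → <⇒≱ (ltα⇒<F (n ∸ suc q) t)
        (m+n≤o⇒m≤o∸n (suc (F n)) (≤-trans (≤-reflexive (+-comm (suc (F n)) (suc q)))
          (≤-trans (+-monoˡ-≤ (suc (F n)) lt) (≤-reflexive (m∸n+n≡m F<n)))))

    Counted : List Letter → Set
    Counted u = IsFactor x u × (length u ≡ n) × (counta u ≡ floorN1mα m n) × (countb u ≡ ceilNα m n)

    rich-counted : ∀ i → bs i n ≡ suc (F n) → Counted (factorAt x i n)
    rich-counted i e = (i , cong (factorAt x i) (sym (factor-length i n))) , factor-length i n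
      , trans as (sym floor≡) , trans e (sym ceil≡)
      where
      as : counta (factorAt x i n) ≡ n ∸ suc (F n)
      as = trans (sym (m+n∸n≡m (counta (factorAt x i n)) (suc (F n))))
        (cong (_∸ suc (F n)) (trans (cong (counta (factorAt x i n) +_) (sym e))
          (trans (counta+countb (factorAt x i n)) (factor-length i n))))

    peak≼⇒rich : ∀ {i t} → Peak i t n → 1 ≤ t → t ≤ n → t ≼ n → bs i n ≡ suc (F n)
    peak≼⇒rich {i} {t} p 1≤t t≤n t≼n with m≤n⇒∃[o]m+o≡n t≤n
    ... | k , refl = trans (peak-count p 1≤t) (cong suc (≼⇒F-+ t k t≼n))

    peak-rich⇒≼ : ∀ {i t} → Peak i t n → t ≤ n → bs i n ≡ suc (F n) → 1 ≤ t × t ≼ n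
    -- A window peaking at its start has only `F n` letters b.
    peak-rich⇒≼ {i} {zero} p _ e = ⊥-elim (1+n≢n (trans (sym e)
      (trans (cong (λ z → bs z n) (sym (+-identityʳ i))) (Peak.after p n ≤-refl))))
    peak-rich⇒≼ {i} {t@(suc _)} p t≤n e with m≤n⇒∃[o]m+o≡n t≤n
    ... | k , refl = s≤s z≤n , F-+⇒≼ t k (suc-injective (trans (sym (peak-count p (s≤s z≤n))) e))

    ranks-count : ∀ {L} → RankList n L → PαIs m x n (length L)
    ranks-count {L} R = map factor L
      , unique-map factor factor-injective R.unique
      , length-map factor L
      , (λ u u∈ → sound (∈-map⁻ factor u∈))
      , (λ { u ((i , u≡) , len , _ , ceil) → complete i (trans u≡ (cong (factorAt x i) len)) (trans ceil ceil≡) })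
      where
      module R = RankList R
      factor : ℕ → List Letter
      factor t = factorAt x (centre ∸ t) n
      factor-injective : ∀ {s t} → s ∈ L → t ∈ L → factor s ≡ factor t → s ≡ t
      factor-injective s∈L t∈L =
        let _ , s≤n , _ = R.sound s∈L
            _ , t≤n , _ = R.sound t∈L
        in peak-injective s≤n t≤n (peak-centre n<P s≤n) (peak-centre n<P t≤n)
      sound : ∀ {u} → (∃ λ t → t ∈ L × u ≡ factor t) → Counted u
      sound (t , t∈L , refl) =
        let 1≤t , t≤n , t≼n = R.sound t∈L
        in rich-counted (centre ∸ t) (peak≼⇒rich (peak-centre n<P t≤n) 1≤t t≤n t≼n)
      complete : ∀ {u} i → u ≡ factorAt x i n → countb u ≡ suc (F n) → u ∈ map factor L
      complete i refl e =
        let t , t≤n , p = peak-exists i n n<Q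
            1≤t , t≼n = peak-rich⇒≼ p t≤n e
        in subst (_∈ map factor L) (peak-factor (peak-centre n<P t≤n) p 1≤t)
             (∈-map⁺ factor (R.complete 1≤t t≤n t≼n))

theorem9 : ∀ (m : ℕ) → 3 ≤ m → ∀ (n : ℕ) → 1 ≤ n → ∀ (N : ℕ) (d : ℕ → ℕ) →
    IsUExpansion m n N d →
    ∀ (x : Seq) → IsSturmianα m x →
    PαIs m x n (formula m N d)
theorem9 m 3≤m n 1≤n N d (refl , _ , greedy) x (balanced , _ , frequency) =
  -- `K = suc N` makes `P` equal to U_{N+1}, which exceeds `n` by the last greedy inequality.
  let L , R , len , _ = Expansion.ranks-expansion m 3≤m (suc N) d N (n≤1+n N) greedy
  in subst (PαIs m x n) len
       (Counting.ranks-count m 3≤m (suc N) x balanced frequency 1≤n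
         (subst (n <_) (U≡V m (suc N)) (greedy N ≤-refl)) R)
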